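{- Let $n\ge 4$ and $d\ge 3$ be integers, and let $Y$ be the single voltage cover of the complete graph $K_n$ by the cyclic group of order $d$. Then $$\mathcal J(Y)\cong (\mathbb Z/n\mathbb Z)^{(n-4)d+2}\oplus(\mathbb Z/n(n-2)\mathbb Z)^{d-2}\oplus \mathbb Z/dn(n-2)\mathbb Z .$$ In particular, $|\mathcal J(Y)|=n^{(n-3)d+1}\,(n-2)^{d-1}\,d$, and the rank of $\mathcal J(Y)$ (its number of invariant factors, i.e. its minimal number of generators) is $(n-3)d+1$.
   Context: Graphs are simple (no loops or multiple edges). For a finite connected graph $Y$ with Laplacian $L=D-A$ (degree matrix minus adjacency matrix), a reduced Laplacian $\widetilde L$ is obtained by deleting the row and column of one vertex, and the Jacobian of $Y$ is the finite abelian group $\mathcal J(Y)=\mathrm{coker}(\widetilde L)$ (up to isomorphism independent of the vertex chosen). Single voltage cover of $K_n$ by the cyclic group $G=\langle\tau\rangle$ of order $d$: label the vertices of $K_n$ as $v_1,\dots,v_n$. Assign to the directed edge $v_1\to v_2$ the voltage $\alpha_{1,2}=\tau$, to $v_2\to v_1$ the voltage $\alpha_{2,1}=\tau^{ -1}$, and to every other directed edge $v_i\to v_j$ the voltage $\alpha_{i,j}=1$ (the identity). The cover (derived graph) $Y$ has vertex set $\{v_{i,g}: 1\le i\le n,\ g\in G\}$, and $v_{i,g}$ is adjacent to $v_{j,h}$ if and only if $i\ne j$ and $h=g\alpha_{i,j}$. -}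

module Defs where

open import Algebra.Bundles using (AbelianGroup)
import Algebra.Construct.DirectProduct as DirectProduct
import Algebra.Construct.Pointwise as Pointwise
import Algebra.Construct.Terminal as Terminal
open import Algebra.Morphism.Structures using (module GroupMorphisms)
import Algebra.Properties.AbelianGroup as AbelianGroupProperties
import Algebra.Properties.CommutativeSemigroup as CommutativeSemigroupProperties
open import Data.Bool.Base using (if_then_else_)
open import Data.Fin.Base using (Fin; zero; suc; toℕ; punchIn; remQuot)
import Data.Fin.Properties as Fin
open import Data.Integer.Base as ℤ using (ℤ; +_; 0ℤ; 1ℤ; -1ℤ)
import Data.Integer.Divisibility.Signed as ℤ∣
import Data.Integer.Properties as ℤ
open import Data.List.Base using (List; foldr)
open import Data.List.Relation.Unary.All using (All)
open import Data.List.Relation.Unary.Linked using (Linked)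
open import Data.Nat.Base as ℕ using (ℕ; suc; pred)
import Data.Nat.Divisibility as ℕ∣
open import Data.Product.Base using (Σ; ∃; _×_; _,_; proj₁; proj₂)
open import Data.Vec.Functional using (Vector)
open import Function.Base using (_∘_)
open import Function.Bundles using (Inverse)
open import Level using (Level; 0ℓ; _⊔_) renaming (suc to lsuc)
open import Relation.Binary.Core using (Rel)
open import Relation.Binary.Definitions using (Decidable; Symmetric; Irreflexive)
import Relation.Binary.Reasoning.Setoid as ≈-Reasoning
open import Relation.Binary.PropositionalEquality
  using (_≡_; _≢_; refl; sym; trans; cong; cong₂; subst; setoid; ≢-sym)
open import Relation.Nullary.Decidable using (does; ¬?; _×-dec_)

open import Algebra.Properties.Semiring.Sum ℤ.+-*-semiring
  using (sum; sum-cong-≗; ∑-distrib-+; sum-replicate-zero; *-distribˡ-sum)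

private
  variable
    a b ℓ ℓ₁ ℓ₂ p : Level
    k m n N d : ℕ

infix 4 _≅_
_≅_ : AbelianGroup a ℓ₁ → AbelianGroup b ℓ₂ → Set (a ⊔ b ⊔ ℓ₁ ⊔ ℓ₂)
A ≅ B = Σ (A.Carrier → B.Carrier)
          (GroupMorphisms.IsGroupIsomorphism A.rawGroup B.rawGroup)
  where
  module A = AbelianGroup A
  module B = AbelianGroup B

infixr 6 _⊕_
_⊕_ : AbelianGroup a ℓ₁ → AbelianGroup b ℓ₂ → AbelianGroup (a ⊔ b) (ℓ₁ ⊔ ℓ₂)
_⊕_ = DirectProduct.abelianGroup

infixl 8 _^^_
_^^_ : AbelianGroup a ℓ → ℕ → AbelianGroup a ℓ
A ^^ k = Pointwise.abelianGroup (Fin k) A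

record Subgroup (A : AbelianGroup a ℓ) p : Set (a ⊔ ℓ ⊔ lsuc p) where
  open AbelianGroup A
  field
    Member : Carrier → Set p
    resp   : ∀ {x y} → x ≈ y → Member x → Member y
    ε∈     : Member ε
    ∙∈     : ∀ {x y} → Member x → Member y → Member (x ∙ y)
    ⁻¹∈    : ∀ {x} → Member x → Member (x ⁻¹)

module _ (A : AbelianGroup a ℓ) (S : Subgroup A p) where
  private
    module A = AbelianGroup A
  open AbelianGroup A using (Carrier; _≈_; _∙_; _⁻¹; ε)
  open Subgroup S
  open AbelianGroupProperties A
  open CommutativeSemigroupProperties A.commutativeSemigroup using (interchange)

  private
    _∼_ : Rel Carrier _
    x ∼ y = Member (x ∙ y ⁻¹)

    ≈⇒∼ : ∀ {x y} → x ≈ y → x ∼ y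
    ≈⇒∼ {x} {y} x≈y =
      resp (A.sym (A.trans (A.∙-congʳ x≈y) (A.inverseʳ y))) ε∈

    ∼-sym : ∀ {x y} → x ∼ y → y ∼ x
    ∼-sym {x} {y} x∼y = resp
      (A.trans (A.sym (⁻¹-∙-comm x (y ⁻¹)))
        (A.trans (A.∙-congˡ (⁻¹-involutive y)) (A.comm (x ⁻¹) y)))
      (⁻¹∈ x∼y)

    ∼-trans : ∀ {x y z} → x ∼ y → y ∼ z → x ∼ z
    ∼-trans {x} {y} {z} x∼y y∼z = resp
      (A.trans (A.assoc x (y ⁻¹) (y ∙ z ⁻¹))
        (A.∙-congˡ (A.trans (A.sym (A.assoc (y ⁻¹) y (z ⁻¹)))
          (A.trans (A.∙-congʳ (A.inverseˡ y)) (A.identityˡ (z ⁻¹))))))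
      (∙∈ x∼y y∼z)

    ∼-∙-cong : ∀ {x y u v} → x ∼ y → u ∼ v → (x ∙ u) ∼ (y ∙ v)
    ∼-∙-cong {x} {y} {u} {v} x∼y u∼v = resp
      (A.trans (interchange x (y ⁻¹) u (v ⁻¹)) (A.∙-congˡ (⁻¹-∙-comm y v)))
      (∙∈ x∼y u∼v)

    ∼-⁻¹-cong : ∀ {x y} → x ∼ y → (x ⁻¹) ∼ (y ⁻¹)
    ∼-⁻¹-cong {x} {y} x∼y = resp (A.sym (⁻¹-∙-comm x (y ⁻¹))) (⁻¹∈ x∼y)

  quotient : AbelianGroup a p
  quotient = record
    { Carrier = Carrier
    ; _≈_     = _∼_
    ; _∙_     = _∙_
    ; ε       = ε
    ; _⁻¹     = _⁻¹
    ; isAbelianGroup = record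
      { isGroup = record
        { isMonoid = record
          { isSemigroup = record
            { isMagma = record
              { isEquivalence = record
                { refl = ≈⇒∼ A.refl ; sym = ∼-sym ; trans = ∼-trans }
              ; ∙-cong = ∼-∙-cong
              }
            ; assoc = λ x y z → ≈⇒∼ (A.assoc x y z)
            }
          ; identity = (λ x → ≈⇒∼ (A.identityˡ x)) , (λ x → ≈⇒∼ (A.identityʳ x))
          }
        ; inverse = (λ x → ≈⇒∼ (A.inverseˡ x)) , (λ x → ≈⇒∼ (A.inverseʳ x))
        ; ⁻¹-cong = ∼-⁻¹-cong
        }
      ; comm = λ x y → ≈⇒∼ (A.comm x y)
      }
    }

multiples : ℕ → Subgroup ℤ.+-0-abelianGroup 0ℓ
multiples k = record
  { Member = + k ℤ∣.∣_
  ; resp   = subst (+ k ℤ∣.∣_)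
  ; ε∈     = ℤ∣.divides 0ℤ refl
  ; ∙∈     = ℤ∣.∣m∣n⇒∣m+n
  ; ⁻¹∈    = ℤ∣.∣m⇒∣-m
  }

infix 9 ℤ/_
ℤ/_ : ℕ → AbelianGroup 0ℓ 0ℓ
ℤ/ k = quotient ℤ.+-0-abelianGroup (multiples k)

cyclicSum : List ℕ → AbelianGroup 0ℓ 0ℓ
cyclicSum = foldr (λ k A → ℤ/ k ⊕ A) Terminal.abelianGroup

HasOrder : AbelianGroup a ℓ → ℕ → Set (a ⊔ ℓ)
HasOrder A k = Inverse (AbelianGroup.setoid A) (setoid (Fin k))

record InvariantFactors (A : AbelianGroup a ℓ) (ds : List ℕ) : Set (a ⊔ ℓ) where
  field
    nontrivial    : All (1 ℕ.<_) ds
    divisibility  : Linked ℕ∣._∣_ ds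
    decomposition : A ≅ cyclicSum ds

module _ (A : AbelianGroup a ℓ) where
  open AbelianGroup A

  data ⟨_⟩ {k} (g : Vector Carrier k) : Carrier → Set (a ⊔ ℓ) where
    gen  : ∀ i → ⟨ g ⟩ (g i)
    unit : ⟨ g ⟩ ε
    mul  : ∀ {x y} → ⟨ g ⟩ x → ⟨ g ⟩ y → ⟨ g ⟩ (x ∙ y)
    inv  : ∀ {x} → ⟨ g ⟩ x → ⟨ g ⟩ (x ⁻¹)
    resp : ∀ {x y} → x ≈ y → ⟨ g ⟩ x → ⟨ g ⟩ y

  Generates : Vector Carrier k → Set (a ⊔ ℓ)
  Generates g = ∀ x → ⟨ g ⟩ x

  MinimalNumberOfGenerators : ℕ → Set (a ⊔ ℓ)
  MinimalNumberOfGenerators r =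
    (∃ λ (g : Vector Carrier r) → Generates g) ×
    (∀ s (g : Vector Carrier s) → Generates g → r ℕ.≤ s)

Matrix : ℕ → ℕ → Set
Matrix m n = Fin m → Fin n → ℤ

infixr 7 _*ᵥ_
_*ᵥ_ : Matrix m n → Vector ℤ n → Vector ℤ m
(M *ᵥ z) i = sum (λ j → M i j ℤ.* z j)

image : Matrix m n → Subgroup (ℤ.+-0-abelianGroup ^^ m) 0ℓ
image {m} {n} M = record
  { Member = λ x → ∃ λ z → ∀ i → x i ≡ (M *ᵥ z) i
  ; resp   = λ x≈y (z , eq) → z , λ i → trans (sym (x≈y i)) (eq i)
  ; ε∈     = (λ _ → 0ℤ) , λ i → sym
      (trans (sum-cong-≗ (λ j → ℤ.*-zeroʳ (M i j))) (sum-replicate-zero n))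
  ; ∙∈     = λ (z , p) (w , q) → (λ j → z j ℤ.+ w j) , λ i →
      trans (cong₂ ℤ._+_ (p i) (q i))
        (trans (sym (∑-distrib-+ (λ j → M i j ℤ.* z j) (λ j → M i j ℤ.* w j)))
          (sum-cong-≗ (λ j → sym (ℤ.*-distribˡ-+ (M i j) (z j) (w j)))))
  ; ⁻¹∈    = λ (z , p) → (λ j → ℤ.- z j) , λ i →
      trans (cong ℤ.-_ (p i)) (trans (sym (ℤ.-1*i≡-i _))
        (trans (*-distribˡ-sum -1ℤ (λ j → M i j ℤ.* z j))
          (sum-cong-≗ (λ j → trans (ℤ.-1*i≡-i _) (ℤ.neg-distribʳ-* (M i j) (z j))))))
  }

coker : Matrix m n → AbelianGroup 0ℓ 0ℓ
coker {m} M = quotient (ℤ.+-0-abelianGroup ^^ m) (image M)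

record Graph (N : ℕ) : Set₁ where
  field
    Adjacent    : Rel (Fin N) 0ℓ
    adjacent?   : Decidable Adjacent
    symmetric   : Symmetric Adjacent
    irreflexive : Irreflexive _≡_ Adjacent

module _ (X : Graph N) where
  open Graph X

  adjacencyMatrix : Matrix N N
  adjacencyMatrix i j = if does (adjacent? i j) then 1ℤ else 0ℤ

  degree : Fin N → ℤ
  degree i = sum (adjacencyMatrix i)

  degreeMatrix : Matrix N N
  degreeMatrix i j = if does (i Fin.≟ j) then degree i else 0ℤ

  laplacian : Matrix N N
  laplacian i j = degreeMatrix i j ℤ.- adjacencyMatrix i j

delete : Matrix N N → Fin N → Matrix (pred N) (pred N)
delete {suc _} M v i j = M (punchIn v i) (punchIn v j)

Jacobian : Graph N → Fin N → AbelianGroup 0ℓ 0ℓ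
Jacobian X v = coker (delete (laplacian X) v)

private
  transpose : (A : AbelianGroup a ℓ) → let open AbelianGroup A in
              ∀ g h s t → h ≈ g ∙ s → t ≈ s ⁻¹ → g ≈ h ∙ t
  transpose A g h s t h≈gs t≈s⁻¹ = begin
    g               ≈⟨ identityʳ g ⟨
    g ∙ ε           ≈⟨ ∙-congˡ (inverseʳ s) ⟨
    g ∙ (s ∙ s ⁻¹)  ≈⟨ assoc g s (s ⁻¹) ⟨
    (g ∙ s) ∙ s ⁻¹  ≈⟨ ∙-cong h≈gs t≈s⁻¹ ⟨
    h ∙ t           ∎
    where
    open AbelianGroup A using
      (_∙_; _⁻¹; ε; identityʳ; inverseʳ; assoc; ∙-cong; ∙-congˡ)
    open ≈-Reasoning (AbelianGroup.setoid A)

-- The voltage group is ℤ/ d written additively, with τ = 1; its elements are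
-- listed without repetition by Fin d when d ≥ 1.

record VoltageAssignment (n d : ℕ) : Set where
  open AbelianGroup (ℤ/ d)
  field
    α     : Fin n → Fin n → Carrier
    α-inv : ∀ i j → α j i ≈ α i j ⁻¹

-- The vertex v_{i,g} is combine i g : Fin (n * d).

cover : VoltageAssignment n d → Graph (n ℕ.* d)
cover {n} {d} V = record
  { Adjacent    = Adjacent
  ; adjacent?   = λ x y →
      ¬? (base x Fin.≟ base y) ×-dec (+ d ℤ∣.∣? _)
  ; symmetric   = λ {x} {y} (i≢j , h≈gα) → ≢-sym i≢j ,
      transpose (ℤ/ d) (fibre x) (fibre y) (α (base x) (base y)) (α (base y) (base x))
        h≈gα (α-inv (base x) (base y))
  ; irreflexive = λ { refl (i≢i , _) → i≢i refl }
  }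
  where
  open VoltageAssignment V
  open AbelianGroup (ℤ/ d) using (Carrier; _≈_; _∙_)

  base : Fin (n ℕ.* d) → Fin n
  base x = proj₁ (remQuot d x)

  fibre : Fin (n ℕ.* d) → Carrier
  fibre x = + toℕ (proj₂ (remQuot {n} d x))

  Adjacent : Rel (Fin (n ℕ.* d)) 0ℓ
  Adjacent x y = base x ≢ base y × fibre y ≈ fibre x ∙ α (base x) (base y)

singleVoltage : Fin n → Fin n → ℤ
singleVoltage zero       (suc zero) = 1ℤ
singleVoltage (suc zero) zero       = -1ℤ
singleVoltage _          _          = 0ℤ

singleVoltage-inv : ∀ (i j : Fin n) → singleVoltage j i ≡ ℤ.- singleVoltage i j
singleVoltage-inv zero          zero          = refl
singleVoltage-inv zero          (suc zero)    = refl
singleVoltage-inv zero          (suc (suc _)) = refl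
singleVoltage-inv (suc zero)    zero          = refl
singleVoltage-inv (suc zero)    (suc zero)    = refl
singleVoltage-inv (suc zero)    (suc (suc _)) = refl
singleVoltage-inv (suc (suc _)) zero          = refl
singleVoltage-inv (suc (suc _)) (suc zero)    = refl
singleVoltage-inv (suc (suc _)) (suc (suc _)) = refl

singleVoltageCover : ∀ n d → Graph (n ℕ.* d)
singleVoltageCover n d = cover {n} {d} record
  { α     = singleVoltage
  ; α-inv = λ i j → AbelianGroup.reflexive (ℤ/ d) (singleVoltage-inv i j)
  }

module Submission where

-- Eliminate generators from the cokernel of the Laplacian.  Write a_g, b_g, c_g for the classes
-- of v_{1,g}, v_{2,g}, v_{3,g}.  The relations say that n v_{i,g} equals the sum of the v_{j,g}
-- over j, corrected by b_{g+1} - b_g for i = 1 and by a_{g-1} - a_g for i = 2.  So the differences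
-- v_{i,g} - v_{3,g} with i > 4 generate copies of ℤ/n, the sum over j eliminates v_{4,g}, and the
-- relation for v_{4,g} then says that t = b_g - a_{g-1} does not depend on g.  Put u_g = a_g - c_g;
-- then n u_g = a_g - a_{g-1}, and in degree 0 only the generators t and u_g are left, subject to
-- n t = n(n-2) u_g and n Σ_g u_g = 0.  The generators t - (n-2) u_1, Σ_g u_g, u_g - u_1 (g ≥ 2)
-- and u_1 diagonalise these relations.
--
-- The rank is bounded below by counting: if s elements generate a group that maps onto (ℤ/p)^r,
-- then p^r ≤ p^s.

open import Defs
open import Algebra.Bundles using (AbelianGroup)
import Algebra.Construct.Terminal as Terminal
open import Algebra.Morphism.Construct.Composition using (isGroupIsomorphism)
open import Algebra.Morphism.Structures using (module GroupMorphisms)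
import Algebra.Properties.AbelianGroup as AbelianGroupProperties
open import Data.Bool.Base using (if_then_else_)
open import Data.Fin.Base as Fin using
  (Fin; zero; suc; toℕ; fromℕ; fromℕ<; inject₁; combine; remQuot; funToFin; finToFun;
   _↑ˡ_; _↑ʳ_; punchIn; punchOut; splitAt)
open import Data.Fin.Induction using (<-weakInduction)
open import Data.Fin.Patterns using (0F; 1F; 2F; 3F)
open import Data.Fin.Permutation using (permutation)
import Data.Fin.Properties as Fin
open import Data.Fin.Relation.Unary.Top using (view; ‵fromℕ; ‵inj₁)
open import Data.Integer.Base as ℤ using (ℤ; +_; -[1+_]; 0ℤ; 1ℤ; -1ℤ; ∣_∣)
open import Data.Integer.DivMod using (_%ℕ_; _/ℕ_; n%ℕd<d; a≡a%ℕn+[a/ℕn]*n)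
open import Data.Integer.Divisibility.Signed as ℤ∣ using (divides)
import Data.Integer.Properties as ℤ
open import Data.Integer.Tactic.RingSolver using (solve-∀)
open import Data.List.Base using (List; []; _∷_; _++_; [_]; length; replicate)
open import Data.List.Properties using (length-++; length-replicate)
open import Data.List.Relation.Unary.All as All using (All; []; _∷_)
import Data.List.Relation.Unary.All.Properties as All
open import Data.List.Relation.Unary.Linked using (Linked; [-]; _∷_)
open import Data.List.Relation.Unary.Linked.Properties using (Linked⇒All)
open import Data.Nat.Base as ℕ using (ℕ; NonZero; s≤s; z≤n)
import Data.Nat.Divisibility as ℕ∣
open import Data.Nat.ListAction using (product)
open import Data.Nat.ListAction.Properties using (product-++)
import Data.Nat.Properties as ℕ
import Data.Nat.Tactic.RingSolver as ℕ-Solver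
open import Data.Product.Base using (∃; _×_; _,_; proj₁; proj₂; uncurry)
open import Data.Sum.Base using (inj₁; inj₂)
open import Data.Unit.Polymorphic.Base using (tt)
import Data.Vec.Functional as Vector
open import Data.Vec.Functional using (Vector; insertAt)
open import Data.Vec.Functional.Properties
  using (insertAt-lookup; insertAt-punchIn; lookup-++ˡ; lookup-++ʳ)
open import Function.Base using (_∘_)
open import Function.Bundles using (Inverse)
open import Level using (Level; 0ℓ)
open import Relation.Binary.PropositionalEquality
  using (_≡_; _≢_; refl; ≢-sym; sym; trans; cong; cong₂; subst; module ≡-Reasoning)
open import Relation.Nullary.Decidable using
  (Dec; does; yes; no; ¬?; _×-dec_; dec-true; dec-false)
open import Relation.Nullary.Negation using (contradiction)

open import Algebra.Properties.Semiring.Sum ℤ.+-*-semiring using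
  (sum; sum-cong-≗; ∑-distrib-+; ∑-comm; sum-permute; sum-replicate-zero; sum-remove;
   *-distribˡ-sum)

-- No generator is literally eliminated. The relations are turned into an additive map `Φ` on
-- integer fields, and the isomorphism amounts to two facts: among fields of degree 0, `Φ` kills
-- exactly those of the form `Δ z`, and fields of degree 0 reach every element of the target. That
-- `Δ z` is killed is a substitution; the obstacle is to produce `z` from a field that `Φ` kills.
-- Its layers are coupled by cyclic shifts, so `z` arises by summation along the cycle, which closes
-- up only if the totals vanish. Degree 0 and the relation for `T` are the two closing conditions.
-- Using degree 0 and the full Laplacian instead of a deleted row and column keeps the cyclic
-- symmetry and treats all `v` alike. The factor d of the last summand arises as follows: all n(n-2)
-- u_g equal n t, so d n(n-2) u_1 = (n-2) n Σ_g u_g = 0.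

private
  variable
    a b c ℓ ℓ₁ ℓ₂ ℓ₃ : Level
    A : AbelianGroup a ℓ₁
    B : AbelianGroup b ℓ₂
    C : AbelianGroup c ℓ₃

-- Isomorphisms of abelian groups

module _ {A : AbelianGroup a ℓ₁} {B : AbelianGroup b ℓ₂} where
  private
    module A = AbelianGroup A
    module B = AbelianGroup B
    module AP = AbelianGroupProperties A
    module BP = AbelianGroupProperties B

  -- In quotient groups `≈` is membership of a difference in a subgroup, so it is easiest to test
  -- against `ε`. Congruence and injectivity both follow by applying the kernel conditions to
  -- `x ∙ y ⁻¹`.
  ≅-intro : (f : A.Carrier → B.Carrier) →
            (∀ x y → f (x A.∙ y) B.≈ f x B.∙ f y) →
            (∀ x → x A.≈ A.ε → f x B.≈ B.ε) →
            (∀ x → f x B.≈ B.ε → x A.≈ A.ε) →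
            (∀ y → ∃ λ x → f x B.≈ y) →
            A ≅ B
  ≅-intro f homo ker⁺ ker⁻ onto = f , record
    { isGroupMonomorphism = record
      { isGroupHomomorphism = record
        { isMonoidHomomorphism = record
          { isMagmaHomomorphism = record
            { isRelHomomorphism = record { cong = f-cong }
            ; homo = homo
            }
          ; ε-homo = ker⁺ A.ε A.refl
          }
        ; ⁻¹-homo = f-⁻¹
        }
      ; injective = λ {x} {y} fx≈fy → AP.x∙y⁻¹≈ε⇒x≈y x y
          (ker⁻ _ (B.trans (f-// x y) (BP.x≈y⇒x∙y⁻¹≈ε fx≈fy)))
      }
    ; surjective = λ y → proj₁ (onto y) , λ z≈x → B.trans (f-cong z≈x) (proj₂ (onto y))
    }
    where
    f-⁻¹ : ∀ x → f (x A.⁻¹) B.≈ f x B.⁻¹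
    f-⁻¹ x = BP.inverseʳ-unique (f x) (f (x A.⁻¹))
      (B.trans (B.sym (homo x (x A.⁻¹))) (ker⁺ _ (A.inverseʳ x)))

    f-// : ∀ x y → f (x A.∙ y A.⁻¹) B.≈ f x B.∙ f y B.⁻¹
    f-// x y = B.trans (homo x (y A.⁻¹)) (B.∙-congˡ (f-⁻¹ y))

    f-cong : ∀ {x y} → x A.≈ y → f x B.≈ f y
    f-cong {x} {y} x≈y = BP.x∙y⁻¹≈ε⇒x≈y (f x) (f y)
      (B.trans (B.sym (f-// x y)) (ker⁺ _ (AP.x≈y⇒x∙y⁻¹≈ε x≈y)))

module Iso {A : AbelianGroup a ℓ₁} {B : AbelianGroup b ℓ₂} (A≅B : A ≅ B) where
  private
    module A = AbelianGroup A
    module B = AbelianGroup B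

  to : A.Carrier → B.Carrier
  to = proj₁ A≅B

  open GroupMorphisms.IsGroupIsomorphism (proj₂ A≅B) public
    renaming (⟦⟧-cong to to-cong; ∙-homo to homo)

  from : B.Carrier → A.Carrier
  from y = proj₁ (surjective y)

  to∘from : ∀ y → to (from y) B.≈ y
  to∘from y = proj₂ (surjective y) A.refl

≅-refl : A ≅ A
≅-refl {A = A} = ≅-intro {A = A} {B = A} (λ x → x)
  (λ x y → A.refl) (λ x x≈ε → x≈ε) (λ x x≈ε → x≈ε) (λ x → x , A.refl)
  where module A = AbelianGroup A

≅-sym : A ≅ B → B ≅ A
≅-sym {A = A} {B = B} A≅B = ≅-intro {A = B} {B = A} from
  (λ x y → injective (B.trans (to∘from _) (B.sym
    (B.trans (homo (from x) (from y)) (B.∙-cong (to∘from x) (to∘from y))))))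
  (λ x x≈ε → injective (B.trans (to∘from x) (B.trans x≈ε (B.sym ε-homo))))
  (λ x fx≈ε → B.trans (B.sym (to∘from x)) (B.trans (to-cong fx≈ε) ε-homo))
  (λ x → to x , injective (to∘from (to x)))
  where
  module A = AbelianGroup A
  module B = AbelianGroup B
  open Iso {A = A} {B = B} A≅B

≅-trans : A ≅ B → B ≅ C → A ≅ C
≅-trans {C = C} (f , f-iso) (g , g-iso) =
  g ∘ f , isGroupIsomorphism (AbelianGroup.trans C) f-iso g-iso

⊕-cong : ∀ {a′ b′ ℓ₁′ ℓ₂′} {A : AbelianGroup a ℓ₁} {A′ : AbelianGroup a′ ℓ₁′}
         {B : AbelianGroup b ℓ₂} {B′ : AbelianGroup b′ ℓ₂′} →
         A ≅ A′ → B ≅ B′ → A ⊕ B ≅ A′ ⊕ B′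
⊕-cong {A = A} {A′} {B} {B′} f g = ≅-intro {A = A ⊕ B} {B = A′ ⊕ B′}
  (λ (x , y) → F.to x , G.to y)
  (λ (x , y) (z , w) → F.homo x z , G.homo y w)
  (λ _ (x≈ε , y≈ε) → A′.trans (F.to-cong x≈ε) F.ε-homo , B′.trans (G.to-cong y≈ε) G.ε-homo)
  (λ _ (fx≈ε , gy≈ε) → F.injective (A′.trans fx≈ε (A′.sym F.ε-homo)) ,
                       G.injective (B′.trans gy≈ε (B′.sym G.ε-homo)))
  (λ (x , y) → (F.from x , G.from y) , F.to∘from x , G.to∘from y)
  where
  module A′ = AbelianGroup A′
  module B′ = AbelianGroup B′
  module F = Iso {A = A} {B = A′} f
  module G = Iso {A = B} {B = B′} g

⊕-identityʳ : A ⊕ Terminal.abelianGroup {0ℓ} {0ℓ} ≅ A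
⊕-identityʳ {A = A} = ≅-intro {A = A ⊕ Terminal.abelianGroup {0ℓ} {0ℓ}} {B = A}
  proj₁ (λ x y → A.refl) (λ x → proj₁) (λ x x≈ε → x≈ε , tt) (λ x → (x , tt) , A.refl)
  where module A = AbelianGroup A

^^-zero : (A ^^ 0) ⊕ B ≅ B
^^-zero {A = A} {B = B} = ≅-intro {A = (A ^^ 0) ⊕ B} {B = B}
  proj₂ (λ x y → B.refl) (λ x → proj₂) (λ x x≈ε → (λ ()) , x≈ε)
  (λ x → ((λ ()) , x) , B.refl)
  where module B = AbelianGroup B

^^-suc : ∀ k → (A ^^ ℕ.suc k) ⊕ B ≅ A ⊕ (A ^^ k) ⊕ B
^^-suc {A = A} {B = B} k = ≅-intro {A = (A ^^ ℕ.suc k) ⊕ B} {B = A ⊕ (A ^^ k) ⊕ B}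
  (λ (v , x) → v zero , v ∘ suc , x)
  (λ x y → A.refl , (λ i → A.refl) , B.refl)
  (λ x (v≈ε , x≈ε) → v≈ε zero , v≈ε ∘ suc , x≈ε)
  (λ x (u≈ε , v≈ε , x≈ε) → (λ { zero → u≈ε ; (suc i) → v≈ε i }) , x≈ε)
  (λ (u , v , x) → ((λ { zero → u ; (suc i) → v i }) , x) , A.refl , (λ i → A.refl) , B.refl)
  where
  module A = AbelianGroup A
  module B = AbelianGroup B

cyclicSum-[_] : ∀ k → ℤ/ k ≅ cyclicSum [ k ]
cyclicSum-[ k ] = ≅-sym {A = cyclicSum [ k ]} {B = ℤ/ k} (⊕-identityʳ {A = ℤ/ k})

cyclicSum-replicate : ∀ k m {ds} → B ≅ cyclicSum ds →
                      ((ℤ/ k) ^^ m) ⊕ B ≅ cyclicSum (replicate m k ++ ds)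
cyclicSum-replicate {B = B} k ℕ.zero {ds} e =
  ≅-trans {A = ((ℤ/ k) ^^ 0) ⊕ B} {B = B} {C = cyclicSum ds} (^^-zero {A = ℤ/ k} {B = B}) e
cyclicSum-replicate {B = B} k (ℕ.suc m) {ds} e =
  ≅-trans {A = ((ℤ/ k) ^^ ℕ.suc m) ⊕ B} {B = ℤ/ k ⊕ ((ℤ/ k) ^^ m) ⊕ B}
    {C = ℤ/ k ⊕ cyclicSum (replicate m k ++ ds)}
    (^^-suc {A = ℤ/ k} {B = B} m)
    (⊕-cong {A = ℤ/ k} {A′ = ℤ/ k} {B = ((ℤ/ k) ^^ m) ⊕ B}
      {B′ = cyclicSum (replicate m k ++ ds)} (≅-refl {A = ℤ/ k})
      (cyclicSum-replicate {B = B} k m e))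

-- Residues and orders

-- The difference of two numbers below `k` has absolute value at most their maximum, hence below
-- `k`; a nonzero such difference is too small to be a multiple of `k`.
∣-residues⇒≡ : ∀ {k} {i j : Fin k} → + k ℤ∣.∣ + toℕ i ℤ.- + toℕ j → i ≡ j
∣-residues⇒≡ {k} {i} {j} k∣i-j with ∣ + toℕ i ℤ.- + toℕ j ∣ in eq
... | ℕ.zero = Fin.toℕ-injective (ℤ.+-injective (ℤ.i-j≡0⇒i≡j _ _ (ℤ.∣i∣≡0⇒i≡0 eq)))
... | ℕ.suc r = contradiction
  (ℕ∣.∣⇒≤ (subst (k ℕ∣.∣_) eq (ℤ∣.∣⇒∣ᵤ k∣i-j)))
  (ℕ.<⇒≱ (subst (ℕ._< k) (trans (cong ∣_∣ (sym (ℤ.m-n≡m⊖n (toℕ i) (toℕ j)))) eq)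
    (ℕ.≤-<-trans (ℤ.∣m⊝n∣≤m⊔n (toℕ i) (toℕ j)) (ℕ.⊔-pres-<m (Fin.toℕ<n i) (Fin.toℕ<n j)))))

residue : ∀ k .{{_ : NonZero k}} → ℤ → Fin k
residue k z = fromℕ< (n%ℕd<d z k)

residue-∣ : ∀ k .{{_ : NonZero k}} z → + k ℤ∣.∣ z ℤ.- + toℕ (residue k z)
residue-∣ k z = divides (z /ℕ k) (begin
  z ℤ.- + toℕ (residue k z)                             ≡⟨ cong (λ r → z ℤ.- + r) (Fin.toℕ-fromℕ< (n%ℕd<d z k)) ⟩
  z ℤ.- + (z %ℕ k)                                      ≡⟨ cong (ℤ._- + (z %ℕ k)) (a≡a%ℕn+[a/ℕn]*n z k) ⟩
  + (z %ℕ k) ℤ.+ (z /ℕ k) ℤ.* + k ℤ.- + (z %ℕ k)        ≡⟨ cancel (+ (z %ℕ k)) ((z /ℕ k) ℤ.* + k) ⟩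
  (z /ℕ k) ℤ.* + k                                      ∎)
  where
  open ≡-Reasoning
  cancel : ∀ x y → x ℤ.+ y ℤ.- x ≡ y
  cancel = solve-∀

HasOrder-ℤ/ : ∀ k .{{_ : NonZero k}} → HasOrder (ℤ/ k) k
HasOrder-ℤ/ k = record
  { to        = residue k
  ; from      = λ i → + toℕ i
  ; to-cong   = λ {x} {y} x∼y → unique {x} (Z.trans {x} {y} x∼y (residue-∣ k y))
  ; from-cong = λ { {i} refl → Z.refl {+ toℕ i} }
  ; inverse   = (λ {i} {x} x∼i → unique {x} x∼i)
              , (λ { {x} refl → Z.sym {x} (residue-∣ k x) })
  }
  where
  module Z = AbelianGroup (ℤ/ k)
  unique : ∀ {x i} → x Z.≈ (+ toℕ i) → residue k x ≡ i
  unique {x} {i} x∼i = ∣-residues⇒≡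
    (Z.trans {+ toℕ (residue k x)} {x} {+ toℕ i} (Z.sym {x} (residue-∣ k x)) x∼i)

HasOrder-⊕ : ∀ {m n} → HasOrder A m → HasOrder B n → HasOrder (A ⊕ B) (m ℕ.* n)
HasOrder-⊕ {m = m} {n} F G = record
  { to        = λ (x , y) → combine (F.to x) (G.to y)
  ; from      = λ i → F.from (proj₁ (remQuot n i)) , G.from (proj₂ (remQuot {m} n i))
  ; to-cong   = λ (x≈ , y≈) → cong₂ combine (F.to-cong x≈) (G.to-cong y≈)
  ; from-cong = λ { refl → F.from-cong refl , G.from-cong refl }
  ; inverse   = (λ {i} (x≈ , y≈) → trans (cong₂ combine (F.inverseˡ x≈) (G.inverseˡ y≈))
                                         (Fin.combine-remQuot {m} n i))
              , (λ { {x , y} refl →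
                     F.inverseʳ (cong proj₁ (Fin.remQuot-combine (F.to x) (G.to y)))
                   , G.inverseʳ (cong proj₂ (Fin.remQuot-combine (F.to x) (G.to y))) })
  }
  where
  module F = Inverse F
  module G = Inverse G

HasOrder-≅ : ∀ {k} → A ≅ B → HasOrder B k → HasOrder A k
HasOrder-≅ {A = A} {B = B} A≅B G = record
  { to        = G.to ∘ to
  ; from      = from ∘ G.from
  ; to-cong   = G.to-cong ∘ to-cong
  ; from-cong = λ { refl → A.refl }
  ; inverse   = (λ x≈ → G.inverseˡ (B.trans (to-cong x≈) (to∘from _)))
              , (λ { refl → injective (B.trans (to∘from _) (G.inverseʳ refl)) })
  }
  where
  module A = AbelianGroup A
  module B = AbelianGroup B
  module G = Inverse G
  open Iso {A = A} {B = B} A≅B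

HasOrder-cyclicSum : ∀ {ds} → All NonZero ds → HasOrder (cyclicSum ds) (product ds)
HasOrder-cyclicSum []           = record
  { to = λ _ → zero ; from = λ _ → tt ; to-cong = λ _ → refl ; from-cong = λ _ → tt
  ; inverse = (λ { {zero} _ → refl }) , λ _ → tt }
HasOrder-cyclicSum {d ∷ ds} (d≢0 ∷ ds≢0) =
  HasOrder-⊕ {A = ℤ/ d} {B = cyclicSum ds} (HasOrder-ℤ/ d {{d≢0}}) (HasOrder-cyclicSum ds≢0)

-- Generators

module _ {A : AbelianGroup a ℓ₁} {B : AbelianGroup b ℓ₂}
         (f : AbelianGroup.Carrier A → AbelianGroup.Carrier B)
         (f-isHom : GroupMorphisms.IsGroupHomomorphism
                     (AbelianGroup.rawGroup A) (AbelianGroup.rawGroup B) f) where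
  private module B = AbelianGroup B
  open GroupMorphisms.IsGroupHomomorphism f-isHom

  ⟨⟩-map : ∀ {k m} {g : Vector (AbelianGroup.Carrier A) k} {h : Vector B.Carrier m} →
           (∀ i → ⟨_⟩ B h (f (g i))) → ∀ {x} → ⟨_⟩ A g x → ⟨_⟩ B h (f x)
  ⟨⟩-map fg∈ (gen i)    = fg∈ i
  ⟨⟩-map fg∈ unit       = resp (B.sym ε-homo) unit
  ⟨⟩-map fg∈ (mul x y)  = resp (B.sym (homo _ _)) (mul (⟨⟩-map fg∈ x) (⟨⟩-map fg∈ y))
  ⟨⟩-map fg∈ (inv x)    = resp (B.sym (⁻¹-homo _)) (inv (⟨⟩-map fg∈ x))
  ⟨⟩-map fg∈ (resp e x) = resp (⟦⟧-cong e) (⟨⟩-map fg∈ x)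

Generates-≅ : ∀ {k} {g : Vector (AbelianGroup.Carrier A) k} (A≅B : A ≅ B) →
              Generates A g → Generates B (proj₁ A≅B ∘ g)
Generates-≅ {A = A} {B = B} A≅B gen-A y =
  resp (to∘from y) (⟨⟩-map {A = A} {B = B} to isGroupHomomorphism gen (gen-A (from y)))
  where open Iso {A = A} {B = B} A≅B

MinimalNumberOfGenerators-≅ : ∀ {r} → A ≅ B →
  MinimalNumberOfGenerators A r → MinimalNumberOfGenerators B r
MinimalNumberOfGenerators-≅ {A = A} {B = B} A≅B ((g , gen-A) , r≤) =
  (_ , Generates-≅ {A = A} {B = B} A≅B gen-A) ,
  λ s h gen-B → r≤ s _ (Generates-≅ {A = B} {B = A} (≅-sym {A = A} {B = B} A≅B) gen-B)

basis : ∀ ds → Vector (AbelianGroup.Carrier (cyclicSum ds)) (length ds)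
basis (d ∷ ds) zero    = 1ℤ , AbelianGroup.ε (cyclicSum ds)
basis (d ∷ ds) (suc i) = 0ℤ , basis ds i

basis-generates : ∀ ds → Generates (cyclicSum ds) (basis ds)
basis-generates []       x       = unit
basis-generates (d ∷ ds) (z , c) = resp
  ( Z.reflexive (ℤ.+-identityʳ z) , C.identityˡ c)
  (mul (left z) (⟨⟩-map {A = cyclicSum ds} {B = ℤ/ d ⊕ cyclicSum ds} (0ℤ ,_) inr-isHom
    {g = basis ds} {h = basis (d ∷ ds)} (λ i → gen (suc i)) (basis-generates ds c)))
  where
  module C = AbelianGroup (cyclicSum ds)
  module Z = AbelianGroup (ℤ/ d)
  module CP = AbelianGroupProperties (cyclicSum ds)

  inr-isHom : GroupMorphisms.IsGroupHomomorphism (AbelianGroup.rawGroup (cyclicSum ds))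
                (AbelianGroup.rawGroup (ℤ/ d ⊕ cyclicSum ds)) (0ℤ ,_)
  inr-isHom = record
    { isMonoidHomomorphism = record
      { isMagmaHomomorphism = record
        { isRelHomomorphism = record { cong = Z.refl {0ℤ} ,_ }
        ; homo = λ _ _ → Z.refl {0ℤ} , C.refl
        }
      ; ε-homo = Z.refl {0ℤ} , C.refl
      }
    ; ⁻¹-homo = λ _ → Z.refl {0ℤ} , C.refl
    }

  left⁺ : ∀ k → ⟨_⟩ (cyclicSum (d ∷ ds)) (basis (d ∷ ds)) (+ k , C.ε)
  left⁺ ℕ.zero    = unit
  left⁺ (ℕ.suc k) = resp (Z.refl {+ ℕ.suc k} , C.identityˡ C.ε) (mul (gen zero) (left⁺ k))

  left : ∀ z → ⟨_⟩ (cyclicSum (d ∷ ds)) (basis (d ∷ ds)) (z , C.ε)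
  left (+ k)    = left⁺ k
  left -[1+ k ] = resp (Z.refl { -[1+ k ]} , CP.ε⁻¹≈ε) (inv (left⁺ (ℕ.suc k)))

-- Coordinates of a cyclic sum modulo a common divisor

coordinate : ∀ ds → AbelianGroup.Carrier (cyclicSum ds) → Fin (length ds) → ℤ
coordinate (d ∷ ds) (z , c) zero    = z
coordinate (d ∷ ds) (z , c) (suc i) = coordinate ds c i

fromCoordinates : ∀ ds → (Fin (length ds) → ℤ) → AbelianGroup.Carrier (cyclicSum ds)
fromCoordinates []       z = tt
fromCoordinates (d ∷ ds) z = z zero , fromCoordinates ds (z ∘ suc)

coordinate-fromCoordinates : ∀ ds z i → coordinate ds (fromCoordinates ds z) i ≡ z i
coordinate-fromCoordinates (d ∷ ds) z zero    = refl
coordinate-fromCoordinates (d ∷ ds) z (suc i) = coordinate-fromCoordinates ds (z ∘ suc) i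

-- The coordinates are representatives for different moduli; they become well defined together only
-- after reduction modulo a common divisor.
coordinate-cong : ∀ {p ds} → All (p ℕ∣.∣_) ds → ∀ {x y} → AbelianGroup._≈_ (cyclicSum ds) x y →
                  ∀ i → + p ℤ∣.∣ coordinate ds x i ℤ.- coordinate ds y i
coordinate-cong (p∣d ∷ p∣ds) (z≈w , x≈y) zero    = ℤ∣.∣-trans (ℤ∣.∣ᵤ⇒∣ p∣d) z≈w
coordinate-cong (p∣d ∷ p∣ds) (z≈w , x≈y) (suc i) = coordinate-cong p∣ds x≈y i

coordinate-ε : ∀ ds i → coordinate ds (AbelianGroup.ε (cyclicSum ds)) i ≡ 0ℤ
coordinate-ε (d ∷ ds) zero    = refl
coordinate-ε (d ∷ ds) (suc i) = coordinate-ε ds i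

coordinate-∙ : ∀ ds x y i → coordinate ds (AbelianGroup._∙_ (cyclicSum ds) x y) i ≡
               coordinate ds x i ℤ.+ coordinate ds y i
coordinate-∙ (d ∷ ds) x y zero    = refl
coordinate-∙ (d ∷ ds) x y (suc i) = coordinate-∙ ds _ _ i

coordinate-⁻¹ : ∀ ds x i → coordinate ds (AbelianGroup._⁻¹ (cyclicSum ds) x) i ≡
                ℤ.- coordinate ds x i
coordinate-⁻¹ (d ∷ ds) x zero    = refl
coordinate-⁻¹ (d ∷ ds) x (suc i) = coordinate-⁻¹ ds _ i

sum-single : ∀ {n} (f : Vector ℤ n) i → (∀ j → j ≢ i → f j ≡ 0ℤ) → sum f ≡ f i
sum-single {ℕ.suc n} f i f≡0 = begin
  sum f                             ≡⟨ sum-remove {i = i} f ⟩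
  f i ℤ.+ sum (f ∘ Fin.punchIn i)   ≡⟨ cong (ℤ._+_ (f i)) (sum-cong-≗ (λ j → f≡0 _ (Fin.punchInᵢ≢i i j))) ⟩
  f i ℤ.+ sum {n} (λ _ → 0ℤ)        ≡⟨ cong (ℤ._+_ (f i)) (sum-replicate-zero n) ⟩
  f i ℤ.+ 0ℤ                        ≡⟨ ℤ.+-identityʳ (f i) ⟩
  f i                               ∎
  where open ≡-Reasoning

indicator : ∀ {n} → Fin n → Vector ℤ n
indicator i j = if does (i Fin.≟ j) then 1ℤ else 0ℤ

indicator-≡ : ∀ {n} (i : Fin n) → indicator i i ≡ 1ℤ
indicator-≡ i = cong (if_then 1ℤ else 0ℤ) (dec-true (i Fin.≟ i) refl)

indicator-≢ : ∀ {n} {i j : Fin n} → i ≢ j → indicator i j ≡ 0ℤ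
indicator-≢ {i = i} {j} i≢j = cong (if_then 1ℤ else 0ℤ) (dec-false (i Fin.≟ j) i≢j)

∑-*-indicator : ∀ {n} (f : Vector ℤ n) i → sum (λ j → f j ℤ.* indicator i j) ≡ f i
∑-*-indicator f i = begin
  sum (λ j → f j ℤ.* indicator i j) ≡⟨ sum-single _ i (λ j j≢i →
    trans (cong (f j ℤ.*_) (indicator-≢ (≢-sym j≢i))) (ℤ.*-zeroʳ (f j))) ⟩
  f i ℤ.* indicator i i             ≡⟨ cong (f i ℤ.*_) (indicator-≡ i) ⟩
  f i ℤ.* 1ℤ                        ≡⟨ ℤ.*-identityʳ (f i) ⟩
  f i                               ∎
  where open ≡-Reasoning

∑-cong-mod : ∀ {p n} {f g : Vector ℤ n} → (∀ i → + p ℤ∣.∣ f i ℤ.- g i) → + p ℤ∣.∣ sum f ℤ.- sum g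
∑-cong-mod {p} {ℕ.zero}          f≈g = AbelianGroup.refl (ℤ/ p) {0ℤ}
∑-cong-mod {p} {ℕ.suc n} {f} {g} f≈g = AbelianGroup.∙-cong (ℤ/ p) {f zero} {g zero} {sum (f ∘ suc)} {sum (g ∘ suc)}
  (f≈g zero) (∑-cong-mod (f≈g ∘ suc))

-- The lower bound for the number of generators

module _ {p : ℕ} {ds : List ℕ} .{{_ : NonZero p}} (p∣ds : All (p ℕ∣.∣_) ds)
         {s : ℕ} (g : Vector (AbelianGroup.Carrier (cyclicSum ds)) s) where
  private
    module Zp = AbelianGroup (ℤ/ p)

    M : Matrix (length ds) s
    M j i = coordinate ds (g i) j

  open Subgroup (image M) using (ε∈; ∙∈; ⁻¹∈)

  -- Modulo `p`, the vectors with such coefficients form the image of the matrix `M` whose columns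
  -- are the generators, so the closure properties of `image M` supply the coefficients of products
  -- and inverses.
  ⟨⟩⇒coefficients : ∀ {x} → ⟨_⟩ (cyclicSum ds) g x →
    ∃ λ c → ∀ j → coordinate ds x j Zp.≈ (M *ᵥ c) j
  ⟨⟩⇒coefficients (gen i) = indicator i , λ j → Zp.reflexive (sym (∑-*-indicator (M j) i))
  ⟨⟩⇒coefficients unit =
    let (c , eq) = ε∈ in c , λ j → Zp.reflexive (trans (coordinate-ε ds j) (eq j))
  ⟨⟩⇒coefficients (mul {x} {y} x∈ y∈) =
    let (c , x≈) = ⟨⟩⇒coefficients x∈
        (e , y≈) = ⟨⟩⇒coefficients y∈
        (f , eq) = ∙∈ {M *ᵥ c} {M *ᵥ e} (c , λ _ → refl) (e , λ _ → refl)
    in f , λ j → subst (Zp._≈ (M *ᵥ f) j) (sym (coordinate-∙ ds x y j))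
         (subst ((coordinate ds x j ℤ.+ coordinate ds y j) Zp.≈_) (eq j)
           (Zp.∙-cong {coordinate ds x j} {(M *ᵥ c) j} {coordinate ds y j} {(M *ᵥ e) j} (x≈ j) (y≈ j)))
  ⟨⟩⇒coefficients (inv {x} x∈) =
    let (c , x≈) = ⟨⟩⇒coefficients x∈
        (f , eq) = ⁻¹∈ {M *ᵥ c} (c , λ _ → refl)
    in f , λ j → subst (Zp._≈ (M *ᵥ f) j) (sym (coordinate-⁻¹ ds x j))
         (subst ((ℤ.- coordinate ds x j) Zp.≈_) (eq j)
           (Zp.⁻¹-cong {coordinate ds x j} {(M *ᵥ c) j} (x≈ j)))
  ⟨⟩⇒coefficients (resp {x} {y} x≈y x∈) =
    let (c , x≈) = ⟨⟩⇒coefficients x∈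
    in c , λ j → Zp.trans {coordinate ds y j} {coordinate ds x j} {(M *ᵥ c) j}
         (Zp.sym {coordinate ds x j} {coordinate ds y j} (coordinate-cong p∣ds x≈y j)) (x≈ j)

  -- Reducing the coefficients modulo p embeds (ℤ/p)^r into (ℤ/p)^s.
  generates⇒^≤^ : Generates (cyclicSum ds) g → p ℕ.^ length ds ℕ.≤ p ℕ.^ s
  generates⇒^≤^ generates = Fin.injective⇒≤ encode-injective
    where
    target : Fin (p ℕ.^ length ds) → Vector ℤ (length ds)
    target t j = + toℕ (finToFun {p} {length ds} t j)

    coefficients : Fin (p ℕ.^ length ds) → Vector ℤ s
    coefficients t = proj₁ (⟨⟩⇒coefficients (generates (fromCoordinates ds (target t))))

    correct : ∀ t j → target t j Zp.≈ (M *ᵥ coefficients t) j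
    correct t j = subst (Zp._≈ (M *ᵥ coefficients t) j) (coordinate-fromCoordinates ds (target t) j)
      (proj₂ (⟨⟩⇒coefficients (generates (fromCoordinates ds (target t)))) j)

    encode : Fin (p ℕ.^ length ds) → Fin (p ℕ.^ s)
    encode t = funToFin (residue p ∘ coefficients t)

    distrib : ∀ x y z → x ℤ.* (y ℤ.- z) ≡ x ℤ.* y ℤ.- x ℤ.* z
    distrib = solve-∀

    module _ {t u : Fin (p ℕ.^ length ds)} (eq : encode t ≡ encode u) where

      residues-≡ : ∀ i → residue p (coefficients t i) ≡ residue p (coefficients u i)
      residues-≡ i = begin
        residue p (coefficients t i)  ≡⟨ Fin.finToFun-funToFin (residue p ∘ coefficients t) i ⟨
        finToFun {p} {s} (encode t) i ≡⟨ cong (λ e → finToFun {p} {s} e i) eq ⟩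
        finToFun {p} {s} (encode u) i ≡⟨ Fin.finToFun-funToFin (residue p ∘ coefficients u) i ⟩
        residue p (coefficients u i)  ∎
        where open ≡-Reasoning

      coefficients-≈ : ∀ i → coefficients t i Zp.≈ coefficients u i
      coefficients-≈ i = Zp.trans {coefficients t i} {+ toℕ (residue p (coefficients t i))} {coefficients u i}
        (residue-∣ p (coefficients t i))
        (subst (λ r → (+ toℕ r) Zp.≈ coefficients u i) (sym (residues-≡ i))
          (Zp.sym {coefficients u i} (residue-∣ p (coefficients u i))))

      target-≈ : ∀ j → target t j Zp.≈ target u j
      target-≈ j = Zp.trans {target t j} {(M *ᵥ coefficients t) j} {target u j} (correct t j)
        (Zp.trans {(M *ᵥ coefficients t) j} {(M *ᵥ coefficients u) j} {target u j}
          (∑-cong-mod (λ i → subst (+ p ℤ∣.∣_) (distrib (M j i) (coefficients t i) (coefficients u i))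
            (ℤ∣.∣n⇒∣m*n (M j i) (coefficients-≈ i))))
          (Zp.sym {target u j} {(M *ᵥ coefficients u) j} (correct u j)))

    funToFin-cong : ∀ {m k} {f h : Fin m → Fin k} → (∀ i → f i ≡ h i) → funToFin f ≡ funToFin h
    funToFin-cong {ℕ.zero}  f≗h = refl
    funToFin-cong {ℕ.suc m} f≗h = cong₂ combine (f≗h zero) (funToFin-cong (f≗h ∘ suc))

    encode-injective : ∀ {t u} → encode t ≡ encode u → t ≡ u
    encode-injective {t} {u} eq = begin
      t                                         ≡⟨ Fin.funToFin-finToFin {length ds} {p} t ⟨
      funToFin (finToFun {p} {length ds} t)     ≡⟨ funToFin-cong (λ j → ∣-residues⇒≡ (target-≈ eq j)) ⟩
      funToFin (finToFun {p} {length ds} u)     ≡⟨ Fin.funToFin-finToFin {length ds} {p} u ⟩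
      u                                         ∎
      where open ≡-Reasoning

-- The first invariant factor divides all the others and can itself serve as `p`: the bound compares
-- cardinalities rather than dimensions, so `1 < p` suffices in place of primality.
cyclicSum-rank : ∀ {ds} → All (1 ℕ.<_) ds → Linked ℕ∣._∣_ ds →
                 MinimalNumberOfGenerators (cyclicSum ds) (length ds)
cyclicSum-rank {[]}     _            _      = (basis [] , basis-generates []) , λ _ _ _ → ℕ.z≤n
cyclicSum-rank {p ∷ ds} (1<p ∷ _) linked = (basis (p ∷ ds) , basis-generates (p ∷ ds)) , λ s g generates →
  ℕ.≮⇒≥ λ s<r → ℕ.<⇒≱ (ℕ.^-monoʳ-< p 1<p s<r) (generates⇒^≤^ {{p≢0}} p∣ds g generates)
  where
  p≢0 : NonZero p
  p≢0 = ℕ.>-nonZero (ℕ.<-trans ℕ.z<s 1<p)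

  p∣ds : All (p ℕ∣.∣_) (p ∷ ds)
  p∣ds = Linked⇒All ℕ∣.∣-trans ℕ∣.∣-refl linked

module _ {A : AbelianGroup a ℓ} {ds : List ℕ} (factors : InvariantFactors A ds) where
  open InvariantFactors factors

  invariantFactors⇒rank : MinimalNumberOfGenerators A (length ds)
  invariantFactors⇒rank = MinimalNumberOfGenerators-≅ {A = cyclicSum ds} {B = A}
    (≅-sym {A = A} {B = cyclicSum ds} decomposition) (cyclicSum-rank nontrivial divisibility)

  invariantFactors⇒order : HasOrder A (product ds)
  invariantFactors⇒order = HasOrder-≅ {A = A} {B = cyclicSum ds} decomposition
    (HasOrder-cyclicSum (All.map (λ 1<d → ℕ.>-nonZero (ℕ.<-trans ℕ.z<s 1<d)) nontrivial))

-- Finite sums of integers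

module _ where
  open import Data.Integer.Base using (_+_; _*_; _-_; -_)
  open ≡-Reasoning

  ∑-const : ∀ n x → sum {n} (λ _ → x) ≡ + n * x
  ∑-const ℕ.zero    x = sym (ℤ.*-zeroˡ x)
  ∑-const (ℕ.suc n) x = trans (cong (_+_ x) (∑-const n x)) (sym (ℤ.suc-* (+ n) x))

  ∑-distrib-neg : ∀ {n} (f : Vector ℤ n) → sum (λ i → - f i) ≡ - sum f
  ∑-distrib-neg f = begin
    sum (λ i → - f i)       ≡⟨ sum-cong-≗ (λ i → sym (ℤ.-1*i≡-i (f i))) ⟩
    sum (λ i → -1ℤ * f i)   ≡⟨ *-distribˡ-sum -1ℤ f ⟨
    -1ℤ * sum f             ≡⟨ ℤ.-1*i≡-i (sum f) ⟩
    - sum f                 ∎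

  ∑-distrib-- : ∀ {n} (f g : Vector ℤ n) → sum (λ i → f i - g i) ≡ sum f - sum g
  ∑-distrib-- f g = trans (∑-distrib-+ f (λ i → - g i)) (cong (_+_ (sum f)) (∑-distrib-neg g))

  ∑-++ : ∀ m {n} (f : Vector ℤ (m ℕ.+ n)) → sum f ≡ sum (λ i → f (i ↑ˡ n)) + sum (λ i → f (m ↑ʳ i))
  ∑-++ ℕ.zero    f = sym (ℤ.+-identityˡ (sum f))
  ∑-++ (ℕ.suc m) f = trans (cong (_+_ (f zero)) (∑-++ m (f ∘ suc))) (sym (ℤ.+-assoc (f zero) _ _))

  ∑-combine : ∀ n d (f : Vector ℤ (n ℕ.* d)) → sum f ≡ sum (λ i → sum (λ g → f (combine {n} {d} i g)))
  ∑-combine ℕ.zero    d f = refl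
  ∑-combine (ℕ.suc n) d f = trans (∑-++ d f)
    (cong (_+_ (sum (λ g → f (g ↑ˡ (n ℕ.* d))))) (∑-combine n d (f ∘ (d ↑ʳ_))))

-- Reduced matrices

punchIn-elim : ∀ {n p} {P : Fin (ℕ.suc n) → Set p} v → P v → (∀ j → P (punchIn v j)) → ∀ i → P i
punchIn-elim {P = P} v Pv Pp i with v Fin.≟ i
... | yes refl = Pv
... | no  v≢i  = subst P (Fin.punchIn-punchOut v≢i) (Pp (punchOut v≢i))

module _ where
  open import Data.Integer.Base using (_+_; _*_; _-_; -_)
  open ≡-Reasoning

  -- The cokernel of the reduced Laplacian is the group of vectors of sum 0 modulo the image of
  -- the full Laplacian, through x ↦ balance v x; this is independent of v.
  balance : ∀ {n} → Fin (ℕ.suc n) → Vector ℤ n → Vector ℤ (ℕ.suc n)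
  balance v x = insertAt x v (- sum x)

  module _ {n : ℕ} (v : Fin (ℕ.suc n)) where

    balance-lookup : ∀ x → balance v x v ≡ - sum x
    balance-lookup x = insertAt-lookup x v (- sum x)

    balance-punchIn : ∀ x j → balance v x (punchIn v j) ≡ x j
    balance-punchIn x = insertAt-punchIn x v (- sum x)

    balance-sum : ∀ x → sum (balance v x) ≡ 0ℤ
    balance-sum x = begin
      sum (balance v x)                                    ≡⟨ sum-remove {i = v} (balance v x) ⟩
      balance v x v + sum (balance v x ∘ punchIn v)        ≡⟨ cong₂ _+_ (balance-lookup x) (sum-cong-≗ (balance-punchIn x)) ⟩
      - sum x + sum x                                      ≡⟨ ℤ.+-inverseˡ (sum x) ⟩
      0ℤ                                                   ∎

    balance-unique : ∀ {x} y → (∀ j → y (punchIn v j) ≡ x j) → sum y ≡ 0ℤ → ∀ i → y i ≡ balance v x i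
    balance-unique {x} y y≡x ∑y≡0 = punchIn-elim v
      (begin
        y v                                          ≡⟨ shuffle (y v) (sum (y ∘ punchIn v)) ⟩
        (y v + sum (y ∘ punchIn v)) - sum (y ∘ punchIn v)
          ≡⟨ cong₂ _-_ (trans (sym (sum-remove {i = v} y)) ∑y≡0) (sum-cong-≗ y≡x) ⟩
        0ℤ - sum x                                   ≡⟨ ℤ.+-identityˡ (- sum x) ⟩
        - sum x                                      ≡⟨ balance-lookup x ⟨
        balance v x v                                ∎)
      (λ j → trans (y≡x j) (sym (balance-punchIn x j)))
      where
      shuffle : ∀ a b → a ≡ (a + b) - b
      shuffle = solve-∀

    balance-+ : ∀ x y i → balance v (λ j → x j + y j) i ≡ balance v x i + balance v y i
    balance-+ x y i = sym (balance-unique (λ i → balance v x i + balance v y i)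
      (λ j → cong₂ _+_ (balance-punchIn x j) (balance-punchIn y j))
      (trans (∑-distrib-+ (balance v x) (balance v y)) (cong₂ _+_ (balance-sum x) (balance-sum y))) i)

    balance-punchIn⁻ : ∀ y → sum y ≡ 0ℤ → ∀ i → balance v (y ∘ punchIn v) i ≡ y i
    balance-punchIn⁻ y ∑y≡0 i = sym (balance-unique y (λ j → refl) ∑y≡0 i)

    module _ (M : Matrix (ℕ.suc n) (ℕ.suc n))
             (M-const : ∀ z i → sum (λ j → M i j * z) ≡ 0ℤ)
             (M-sum : ∀ z → sum (M *ᵥ z) ≡ 0ℤ) where

      -- A preimage is extended by 0 at `v`, which leaves the rows other than `v` unchanged. Row `v`
      -- then follows, since both sides have sum 0.
      delete-image⁺ : ∀ {x} → Subgroup.Member (image (delete M v)) x →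
                      ∃ λ z → ∀ i → balance v x i ≡ (M *ᵥ z) i
      delete-image⁺ {x} (z , x≡) = z′ , λ i → sym (balance-unique (M *ᵥ z′) Mz′≡x (M-sum z′) i)
        where
        z′ : Vector ℤ (ℕ.suc n)
        z′ = insertAt z v 0ℤ

        Mz′≡x : ∀ j → (M *ᵥ z′) (punchIn v j) ≡ x j
        Mz′≡x j = begin
          (M *ᵥ z′) (punchIn v j)
            ≡⟨ sum-remove {i = v} (λ k → M (punchIn v j) k * z′ k) ⟩
          M (punchIn v j) v * z′ v + sum (λ k → M (punchIn v j) (punchIn v k) * z′ (punchIn v k))
            ≡⟨ cong₂ _+_ (trans (cong (M (punchIn v j) v *_) (insertAt-lookup z v 0ℤ))
                                (ℤ.*-zeroʳ (M (punchIn v j) v)))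
                 (sum-cong-≗ (λ k → cong (M (punchIn v j) (punchIn v k) *_) (insertAt-punchIn z v 0ℤ k))) ⟩
          0ℤ + (delete M v *ᵥ z) j
            ≡⟨ ℤ.+-identityˡ _ ⟩
          (delete M v *ᵥ z) j
            ≡⟨ x≡ j ⟨
          x j ∎

      -- Constant vectors lie in the kernel of `M`, so `z v` may be subtracted from `z`; the column
      -- of `v` then contributes nothing.
      delete-image⁻ : ∀ {x} z → (∀ i → balance v x i ≡ (M *ᵥ z) i) →
                      Subgroup.Member (image (delete M v)) x
      delete-image⁻ {x} z x≡ = z′ , λ j → begin
        x j                      ≡⟨ balance-punchIn x j ⟨
        balance v x (punchIn v j) ≡⟨ x≡ (punchIn v j) ⟩
        (M *ᵥ z) (punchIn v j)   ≡⟨ step (punchIn v j) ⟩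
        (delete M v *ᵥ z′) j     ∎
        where
        z′ : Vector ℤ n
        z′ j = z (punchIn v j) - z v

        split : ∀ a b c → a * b ≡ a * c + a * (b - c)
        split = solve-∀

        kill : ∀ a b → a * (b - b) ≡ 0ℤ
        kill = solve-∀

        step : ∀ i → (M *ᵥ z) i ≡ sum (λ k → M i (punchIn v k) * z′ k)
        step i = begin
          sum (λ k → M i k * z k)
            ≡⟨ sum-cong-≗ (λ k → split (M i k) (z k) (z v)) ⟩
          sum (λ k → M i k * z v + M i k * (z k - z v))
            ≡⟨ ∑-distrib-+ (λ k → M i k * z v) (λ k → M i k * (z k - z v)) ⟩
          sum (λ k → M i k * z v) + sum (λ k → M i k * (z k - z v))
            ≡⟨ cong₂ _+_ (M-const (z v) i) (sum-remove {i = v} (λ k → M i k * (z k - z v))) ⟩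
          0ℤ + (M i v * (z v - z v) + sum (λ k → M i (punchIn v k) * z′ k))
            ≡⟨ ℤ.+-identityˡ _ ⟩
          M i v * (z v - z v) + sum (λ k → M i (punchIn v k) * z′ k)
            ≡⟨ cong (_+ sum (λ k → M i (punchIn v k) * z′ k)) (kill (M i v) (z v)) ⟩
          0ℤ + sum (λ k → M i (punchIn v k) * z′ k)
            ≡⟨ ℤ.+-identityˡ _ ⟩
          sum (λ k → M i (punchIn v k) * z′ k) ∎

-- The Laplacian of a cover

module _ {d : ℕ} .{{_ : NonZero d}} where

  shift : ℤ → Fin d → Fin d
  shift k g = residue d (+ toℕ g ℤ.+ k)

  shift-unique : ∀ k g h → + d ℤ∣.∣ + toℕ h ℤ.- (+ toℕ g ℤ.+ k) → h ≡ shift k g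
  shift-unique k g h d∣ = ∣-residues⇒≡ {d} {h}
    (AbelianGroup.trans (ℤ/ d) {+ toℕ h} {+ toℕ g ℤ.+ k} d∣ (residue-∣ d (+ toℕ g ℤ.+ k)))

  shift-∣ : ∀ k g → + d ℤ∣.∣ + toℕ (shift k g) ℤ.- (+ toℕ g ℤ.+ k)
  shift-∣ k g = AbelianGroup.sym (ℤ/ d) {+ toℕ g ℤ.+ k} (residue-∣ d (+ toℕ g ℤ.+ k))

module _ {n d : ℕ} .{{_ : NonZero d}} (V : VoltageAssignment n d) where
  open import Data.Integer.Base using (_+_; _*_; _-_; -_)
  open ≡-Reasoning
  open VoltageAssignment V

  private
    Adj Lap : Matrix (n ℕ.* d) (n ℕ.* d)
    Adj = adjacencyMatrix (cover V)
    Lap = laplacian (cover V)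

    -- The adjacency matrix on pairs, before vertices are encoded by `combine`. Decoding an encoded
    -- vertex is then one rewrite per argument.
    entry : Fin n × Fin d → Fin n × Fin d → ℤ
    entry (i , g) (j , h) =
      if does (¬? (i Fin.≟ j) ×-dec (+ d ℤ∣.∣? (+ toℕ h - (+ toℕ g + α i j)))) then 1ℤ else 0ℤ

  adjacency-combine : ∀ i g j h → Adj (combine i g) (combine j h) ≡ entry (i , g) (j , h)
  adjacency-combine i g j h = cong₂ entry (Fin.remQuot-combine i g) (Fin.remQuot-combine j h)

  -- A vertex over `i` has exactly one neighbour over each `j ≢ i` and none over `i`. The indicator
  -- term removes the case `i ≡ j`, so that one formula can be summed over all `j`.
  fibre-sum : ∀ i g j (w : Vector ℤ d) → sum (λ h → entry (i , g) (j , h) * w h) ≡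
              w (shift (α i j) g) - w (shift (α i j) g) * indicator i j
  fibre-sum i g j w with i Fin.≟ j
  ... | yes _  = begin
    sum (λ h → 0ℤ * w h)   ≡⟨ sum-cong-≗ (λ h → ℤ.*-zeroˡ (w h)) ⟩
    sum {d} (λ _ → 0ℤ)     ≡⟨ sum-replicate-zero d ⟩
    0ℤ                     ≡⟨ cancel (w (shift (α i j) g)) ⟩
    w (shift (α i j) g) - w (shift (α i j) g) * 1ℤ ∎
    where
    cancel : ∀ x → 0ℤ ≡ x - x * 1ℤ
    cancel = solve-∀
  ... | no _ = begin
    sum (λ h → weight h * w h)   ≡⟨ sum-single _ t (λ h h≢t → trans (cong (_* w h)
      (cong (if_then 1ℤ else 0ℤ) (dec-false (h? h) (h≢t ∘ shift-unique (α i j) g h)))) (ℤ.*-zeroˡ (w h))) ⟩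
    weight t * w t               ≡⟨ cong (λ b → (if b then 1ℤ else 0ℤ) * w t) (dec-true (h? t) (shift-∣ (α i j) g)) ⟩
    1ℤ * w t                     ≡⟨ simplify (w t) ⟩
    w t - w t * 0ℤ               ∎
    where
    t : Fin d
    t = shift (α i j) g

    h? : ∀ h → Dec (+ d ℤ∣.∣ + toℕ h - (+ toℕ g + α i j))
    h? h = + d ℤ∣.∣? (+ toℕ h - (+ toℕ g + α i j))

    weight : Vector ℤ d
    weight h = if does (h? h) then 1ℤ else 0ℤ

    simplify : ∀ x → 1ℤ * x ≡ x - x * 0ℤ
    simplify = solve-∀

  adjacency-*ᵥ : ∀ z i g → (Adj *ᵥ z) (combine i g) ≡
    sum (λ j → z (combine j (shift (α i j) g))) - z (combine i (shift (α i i) g))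
  adjacency-*ᵥ z i g = begin
    (Adj *ᵥ z) (combine i g)
      ≡⟨ ∑-combine n d (λ y → Adj (combine i g) y * z y) ⟩
    sum (λ j → sum (λ h → Adj (combine i g) (combine {n} {d} j h) * z (combine j h)))
      ≡⟨ sum-cong-≗ (λ j → sum-cong-≗ (λ h → cong (_* z (combine j h)) (adjacency-combine i g j h))) ⟩
    sum (λ j → sum (λ h → entry (i , g) (j , h) * z (combine j h)))
      ≡⟨ sum-cong-≗ (λ j → fibre-sum i g j (λ h → z (combine j h))) ⟩
    sum (λ j → neighbour j - neighbour j * indicator i j)
      ≡⟨ ∑-distrib-- neighbour (λ j → neighbour j * indicator i j) ⟩
    sum neighbour - sum (λ j → neighbour j * indicator i j)
      ≡⟨ cong (_-_ (sum neighbour)) (∑-*-indicator neighbour i) ⟩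
    sum neighbour - neighbour i ∎
    where
    neighbour : Vector ℤ n
    neighbour j = z (combine j (shift (α i j) g))

  -- The degree is the adjacency matrix applied to the constant vector 1.
  degree-cover : ∀ i g → degree (cover V) (combine i g) ≡ + n - 1ℤ
  degree-cover i g = begin
    sum (Adj (combine i g))                     ≡⟨ sum-cong-≗ (λ y → sym (ℤ.*-identityʳ (Adj (combine i g) y))) ⟩
    (Adj *ᵥ (λ _ → 1ℤ)) (combine i g)           ≡⟨ adjacency-*ᵥ (λ _ → 1ℤ) i g ⟩
    sum {n} (λ _ → 1ℤ) - 1ℤ                   ≡⟨ cong (_- 1ℤ) (trans (∑-const n 1ℤ) (ℤ.*-identityʳ (+ n))) ⟩
    + n - 1ℤ                                  ∎

  laplacian-*ᵥ : ∀ z i g → (Lap *ᵥ z) (combine i g) ≡ (+ n - 1ℤ) * z (combine i g) -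
    (sum (λ j → z (combine j (shift (α i j) g))) - z (combine i (shift (α i i) g)))
  laplacian-*ᵥ z i g = begin
    sum (λ y → (degreeMatrix (cover V) x y - Adj x y) * z y)
      ≡⟨ sum-cong-≗ (λ y → distrib (degreeMatrix (cover V) x y) (Adj x y) (z y)) ⟩
    sum (λ y → degreeMatrix (cover V) x y * z y - Adj x y * z y)
      ≡⟨ ∑-distrib-- (λ y → degreeMatrix (cover V) x y * z y) (λ y → Adj x y * z y) ⟩
    sum (λ y → degreeMatrix (cover V) x y * z y) - (Adj *ᵥ z) x
      ≡⟨ cong₂ _-_ diagonal (adjacency-*ᵥ z i g) ⟩
    (+ n - 1ℤ) * z x - (sum (λ j → z (combine j (shift (α i j) g))) - z (combine i (shift (α i i) g))) ∎
    where
    x : Fin (n ℕ.* d)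
    x = combine i g

    distrib : ∀ a b c → (a - b) * c ≡ a * c - b * c
    distrib = solve-∀

    diagonal : sum (λ y → degreeMatrix (cover V) x y * z y) ≡ (+ n - 1ℤ) * z x
    diagonal = begin
      sum (λ y → degreeMatrix (cover V) x y * z y)
        ≡⟨ sum-single _ x (λ y y≢x → trans
             (cong (λ b → (if b then degree (cover V) x else 0ℤ) * z y) (dec-false (x Fin.≟ y) (≢-sym y≢x)))
             (ℤ.*-zeroˡ (z y))) ⟩
      degreeMatrix (cover V) x x * z x
        ≡⟨ cong (λ b → (if b then degree (cover V) x else 0ℤ) * z x) (dec-true (x Fin.≟ x) refl) ⟩
      degree (cover V) x * z x
        ≡⟨ cong (_* z x) (degree-cover i g) ⟩
      (+ n - 1ℤ) * z x ∎

pattern 4+_ i = suc (suc (suc (suc i)))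

-- Cyclic shifts and prefix sums

module _ {d : ℕ} .{{_ : NonZero d}} where
  open import Data.Integer.Base using (_+_; _*_; _-_; -_)

  shift-0 : (g : Fin d) → shift 0ℤ g ≡ g
  shift-0 g = sym (shift-unique 0ℤ g g (divides 0ℤ (identity (+ toℕ g) (+ d))))
    where
    identity : ∀ a k → a - (a + 0ℤ) ≡ 0ℤ * k
    identity = solve-∀

  shift-inverse : ∀ k (g : Fin d) → shift (- k) (shift k g) ≡ g
  shift-inverse k g = sym (shift-unique (- k) (shift k g) g
    (subst (+ d ℤ∣.∣_) (identity (+ toℕ (shift k g)) (+ toℕ g) k) (ℤ∣.∣m⇒∣-m (shift-∣ k g))))
    where
    identity : ∀ s a k → - (s - (a + k)) ≡ a - (s + - k)
    identity = solve-∀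

  next prev : Fin d → Fin d
  next = shift 1ℤ
  prev = shift -1ℤ

  prev-next : ∀ g → prev (next g) ≡ g
  prev-next = shift-inverse 1ℤ

  next-prev : ∀ g → next (prev g) ≡ g
  next-prev = shift-inverse -1ℤ

  ∑-next : ∀ f → sum (f ∘ next) ≡ sum f
  ∑-next f = sym (sum-permute f (permutation next prev next-prev prev-next))

  ∑-prev : ∀ f → sum (f ∘ prev) ≡ sum f
  ∑-prev f = sym (sum-permute f (permutation prev next prev-next next-prev))

module _ where
  open import Data.Integer.Base using (_+_; _*_; _-_; -_)
  open ≡-Reasoning

  next-inject₁ : ∀ {e} (i : Fin e) → next (inject₁ i) ≡ suc i
  next-inject₁ {e} i = sym (shift-unique 1ℤ (inject₁ i) (suc i) (divides 0ℤ (begin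
    + toℕ (suc i) - (+ toℕ (inject₁ i) + 1ℤ)  ≡⟨ cong (λ k → + toℕ (suc i) - (+ k + 1ℤ)) (Fin.toℕ-inject₁ i) ⟩
    (1ℤ + + toℕ i) - (+ toℕ i + 1ℤ)           ≡⟨ identity (+ toℕ i) (+ ℕ.suc e) ⟩
    0ℤ * + ℕ.suc e                            ∎)))
    where
    identity : ∀ a k → (1ℤ + a) - (a + 1ℤ) ≡ 0ℤ * k
    identity = solve-∀

  next-fromℕ : ∀ e → next (fromℕ e) ≡ zero
  next-fromℕ e = sym (shift-unique 1ℤ (fromℕ e) zero (divides -1ℤ (begin
    0ℤ - (+ toℕ (fromℕ e) + 1ℤ)   ≡⟨ cong (λ k → 0ℤ - (+ k + 1ℤ)) (Fin.toℕ-fromℕ e) ⟩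
    0ℤ - (+ e + 1ℤ)               ≡⟨ identity (+ e) ⟩
    -1ℤ * (1ℤ + + e)              ∎)))
    where
    identity : ∀ a → 0ℤ - (a + 1ℤ) ≡ -1ℤ * (1ℤ + a)
    identity = solve-∀

  -- The entry at the argument itself is excluded: the result starts at 0 and its forward difference
  -- is `f`, a discrete antiderivative.
  prefix : ∀ {d} → Vector ℤ d → Vector ℤ d
  prefix f zero    = 0ℤ
  prefix f (suc k) = f zero + prefix (f ∘ suc) k

  prefix-suc : ∀ {e} (f : Vector ℤ (ℕ.suc e)) i → prefix f (suc i) ≡ prefix f (inject₁ i) + f (inject₁ i)
  prefix-suc f zero    = ℤ.+-comm (f zero) 0ℤ
  prefix-suc f (suc i) = trans (cong (_+_ (f zero)) (prefix-suc (f ∘ suc) i))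
    (sym (ℤ.+-assoc (f zero) (prefix (f ∘ suc) (inject₁ i)) (f (suc (inject₁ i)))))

  prefix-last : ∀ {e} (f : Vector ℤ (ℕ.suc e)) → prefix f (fromℕ e) + f (fromℕ e) ≡ sum f
  prefix-last {ℕ.zero}  f = ℤ.+-comm 0ℤ (f zero)
  prefix-last {ℕ.suc e} f = trans (ℤ.+-assoc (f zero) (prefix (f ∘ suc) (fromℕ e)) (f (suc (fromℕ e))))
    (cong (_+_ (f zero)) (prefix-last (f ∘ suc)))

  prefix-cong : ∀ {d} {f h : Vector ℤ d} → (∀ g → f g ≡ h g) → ∀ k → prefix f k ≡ prefix h k
  prefix-cong f≗h zero    = refl
  prefix-cong f≗h (suc k) = cong₂ _+_ (f≗h zero) (prefix-cong (f≗h ∘ suc) k)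

  prefix-0 : ∀ {d} {f : Vector ℤ d} → (∀ g → f g ≡ 0ℤ) → ∀ k → prefix f k ≡ 0ℤ
  prefix-0 f≗0 zero    = refl
  prefix-0 f≗0 (suc k) = cong₂ _+_ (f≗0 zero) (prefix-0 (f≗0 ∘ suc) k)

  prefix-+ : ∀ {d} (f h : Vector ℤ d) k → prefix (λ g → f g + h g) k ≡ prefix f k + prefix h k
  prefix-+ f h zero    = refl
  prefix-+ f h (suc k) = trans (cong (_+_ (f zero + h zero)) (prefix-+ (f ∘ suc) (h ∘ suc) k))
    (interchange (f zero) (h zero) (prefix (f ∘ suc) k) (prefix (h ∘ suc) k))
    where
    interchange : ∀ a b c e → a + b + (c + e) ≡ a + c + (b + e)
    interchange = solve-∀

  module _ {e : ℕ} where

    -- At the last index `next` wraps around to 0, where the prefix sum restarts at 0; the vanishing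
    -- total is what makes the two values agree.
    prefix-next : ∀ (f : Vector ℤ (ℕ.suc e)) → sum f ≡ 0ℤ → ∀ g → prefix f (next g) ≡ prefix f g + f g
    prefix-next f ∑f≡0 g with view g
    ... | ‵fromℕ         = trans (cong (prefix f) (next-fromℕ e)) (sym (trans (prefix-last f) ∑f≡0))
    ... | ‵inj₁ {i = i} _ = trans (cong (prefix f) (next-inject₁ i)) (prefix-suc f i)

    -- The indices below `k` never include the last one, so `next` does not wrap and the differences
    -- telescope.
    prefix-telescope : ∀ (w : Vector ℤ (ℕ.suc e)) k → prefix (λ g → w g - w (next g)) k ≡ w zero - w k
    prefix-telescope w = <-weakInduction (λ k → prefix Δ k ≡ w zero - w k)
      (sym (ℤ.+-inverseʳ (w zero)))
      λ i ih → begin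
        prefix Δ (suc i)                             ≡⟨ prefix-suc Δ i ⟩
        prefix Δ (inject₁ i) + Δ (inject₁ i)         ≡⟨ cong₂ _+_ ih (cong (λ h → w (inject₁ i) - w h) (next-inject₁ i)) ⟩
        (w zero - w (inject₁ i)) + (w (inject₁ i) - w (suc i))
                                                     ≡⟨ telescope (w zero) (w (inject₁ i)) (w (suc i)) ⟩
        w zero - w (suc i)                           ∎
      where
      Δ : Vector ℤ (ℕ.suc e)
      Δ g = w g - w (next g)

      telescope : ∀ a b c → (a - b) + (b - c) ≡ a - c
      telescope = solve-∀

  ∑-affine : ∀ {n} a b (f : Vector ℤ n) → sum (λ i → a + b * f i) ≡ + n * a + b * sum f
  ∑-affine {n} a b f = trans (∑-distrib-+ (λ _ → a) (λ i → b * f i))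
    (cong₂ _+_ (∑-const n a) (sym (*-distribˡ-sum b f)))

  i≡j+[i-j] : ∀ i j → i ≡ j + (i - j)
  i≡j+[i-j] = solve-∀

  -- Transfers a known equation to a goal through an unconditional polynomial identity between the
  -- two differences, which the ring solver can settle.
  ≡-by-difference : ∀ {a b u v} → u ≡ v → a - b ≡ u - v → a ≡ b
  ≡-by-difference {a} {b} {u} refl eq = ℤ.i-j≡0⇒i≡j a b (trans eq (ℤ.+-inverseʳ u))

-- The Laplacian of the single voltage cover

module SingleVoltage (m e : ℕ) where
  open import Data.Integer.Base using (_+_; _*_; _-_; -_)
  open ≡-Reasoning

  n d : ℕ
  n = 4 ℕ.+ m
  d = ℕ.suc e

  N : ℤ
  N = + 4 + + m

  Field : Set
  Field = Fin n → Fin d → ℤ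

  column : Field → Vector ℤ d
  column x g = sum (λ i → x i g)

  -- Each row is the Laplacian of K_n on the layer `g`, that is, `N * z i g - column z g`. The edge
  -- with voltage leads to a neighbouring layer and replaces one neighbour, which gives the
  -- correction in rows `0F` and `1F`.
  Δ : Field → Field
  Δ z 0F            g = N * z 0F g - column z g - (z 1F (next g) - z 1F g)
  Δ z 1F            g = N * z 1F g - column z g - (z 0F (prev g) - z 0F g)
  Δ z (suc (suc i)) g = N * z (suc (suc i)) g - column z g

  Δ-cong : ∀ {z w : Field} → (∀ i g → z i g ≡ w i g) → ∀ i g → Δ z i g ≡ Δ w i g
  Δ-cong {z} {w} z≡w i g = by-row i
    where
    column≡ : column z g ≡ column w g
    column≡ = sum-cong-≗ (λ j → z≡w j g)

    main≡ : ∀ j → N * z j g - column z g ≡ N * w j g - column w g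
    main≡ j = cong₂ (λ a s → N * a - s) (z≡w j g) column≡

    by-row : ∀ i → Δ z i g ≡ Δ w i g
    by-row 0F            = cong₂ _-_ (main≡ 0F) (cong₂ _-_ (z≡w 1F (next g)) (z≡w 1F g))
    by-row 1F            = cong₂ _-_ (main≡ 1F) (cong₂ _-_ (z≡w 0F (prev g)) (z≡w 0F g))
    by-row (suc (suc i)) = main≡ (suc (suc i))

  private
    V : VoltageAssignment n d
    V = record
      { α     = singleVoltage
      ; α-inv = λ i j → AbelianGroup.reflexive (ℤ/ d) (singleVoltage-inv i j)
      }

    L : Matrix (n ℕ.* d) (n ℕ.* d)
    L = laplacian (singleVoltageCover n d)

    row₀ : ∀ N a b b′ r → (N - 1ℤ) * a - ((a + (b′ + r)) - a) ≡ N * a - (a + (b + r)) - (b′ - b)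
    row₀ = solve-∀

    row₁ : ∀ N a b a′ r → (N - 1ℤ) * b - ((a′ + (b + r)) - b) ≡ N * b - (a + (b + r)) - (a′ - a)
    row₁ = solve-∀

    row₂ : ∀ N a s → (N - 1ℤ) * a - (s - a) ≡ N * a - s
    row₂ = solve-∀

  laplacian≡Δ : ∀ w i g → (L *ᵥ w) (combine i g) ≡ Δ (λ j h → w (combine j h)) i g
  laplacian≡Δ w i g = trans (laplacian-*ᵥ V w i g) (expand i)
    where
    z : Field
    z j h = w (combine j h)

    expand : ∀ i → (+ n - 1ℤ) * z i g -
      (sum (λ j → z j (shift (singleVoltage i j) g)) - z i (shift (singleVoltage i i) g)) ≡ Δ z i g
    expand 0F = trans
      (cong (λ h → (+ n - 1ℤ) * z 0F g -
          ((z 0F h + (z 1F (next g) + sum (λ j → z (suc (suc j)) h))) - z 0F h)) (shift-0 g))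
      (row₀ N (z 0F g) (z 1F g) (z 1F (next g)) (sum (λ j → z (suc (suc j)) g)))
    expand 1F = trans
      (cong (λ h → (+ n - 1ℤ) * z 1F g -
          ((z 0F (prev g) + (z 1F h + sum (λ j → z (suc (suc j)) h))) - z 1F h)) (shift-0 g))
      (row₁ N (z 0F g) (z 1F g) (z 0F (prev g)) (sum (λ j → z (suc (suc j)) g)))
    expand (suc (suc i)) = trans
      (cong (λ h → (+ n - 1ℤ) * z (suc (suc i)) g - (column z h - z (suc (suc i)) h)) (shift-0 g))
      (row₂ N (z (suc (suc i)) g) (column z g))

  -- In the notation of the header, a divisor x of degree 0 is equivalent to
  -- T t + Σ_k U_k u_k + Σ η_{i,g} (v_{i,g} - v_{3,g}), the last sum over i > 4.  The partial sums F
  -- come from a_g = a_0 + n (u_1 + ⋯ + u_g).  The vertex v_i has index i - 1, so x₃ belongs to v_4.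
  module Coordinates (x : Field) where
    x₀ x₁ x₂ x₃ R F U : Vector ℤ d
    x₀ = x 0F
    x₁ = x 1F
    x₂ = x 2F
    x₃ = x 3F
    R g = sum (λ i → x (4+ i) g)
    F k = - prefix (column x) k
    -- Obtained from b_g = t + a_g - n u_g, c_g = a_g - u_g, v_{i,g} = c_g + (v_{i,g} - c_g) for i >
    -- 4, and v_{4,g} = a_g - t + (n-3) u_g - Σ_{i>4} (v_{i,g} - c_g). The last one also explains
    -- the subtraction of `x₃` in `η` and `T`. What remains is `column x g` times a_g, which gives
    -- `N * F`.
    U k = N * F k - N * x₁ k - x₂ k - x₃ k - R k + (N - + 2) * x₃ k

    η : Fin m → Vector ℤ d
    η i g = x (4+ i) g - x₃ g

    T : ℤ
    T = sum (λ g → x₁ g - x₃ g)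

  -- The coordinates of x are the combination of the relations n t = n(n-2) u_k, n Σ_k u_k = 0 and
  -- n (v_{i,g} - v_{3,g}) = 0 with coefficients p_k, μ and H_{i,g}.
  record Relation (x : Field) : Set where
    open Coordinates x
    field
      μ  : ℤ
      p  : Vector ℤ d
      H  : Fin m → Vector ℤ d
      T≡ : T ≡ N * sum p
      U≡ : ∀ k → U k ≡ N * μ - N * (N - + 2) * p k
      η≡ : ∀ i g → η i g ≡ N * H i g

  -- The image of `Δ` is cut out by the relations

  module _ (x z : Field) (x≡ : ∀ i g → x i g ≡ Δ z i g) where
    open Coordinates x
    private
      z₀ z₁ z₂ z₃ Z : Vector ℤ d
      z₀ = z 0F
      z₁ = z 1F
      z₂ = z 2F
      z₃ = z 3F
      Z g = sum (λ i → z (4+ i) g)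

      w : Vector ℤ d
      w g = z₁ g - z₀ (prev g)

      p : Vector ℤ d
      p g = z₁ g - z₃ g

      R≡ : ∀ g → R g ≡ + m * (- column z g) + N * Z g
      R≡ g = trans (sum-cong-≗ (λ i → trans (x≡ (4+ i) g) (ℤ.+-comm (N * z (4+ i) g) (- column z g))))
        (∑-affine (- column z g) N (λ i → z (4+ i) g))

      columnwise : ∀ m a b b′ a′ c f r s → s ≡ a + (b + (c + (f + r))) →
        let N = + 4 + m in
        (N * a - s - (b′ - b)) + ((N * b - s - (a′ - a)) + ((N * c - s) + ((N * f - s) + (m * (- s) + N * r))))
          ≡ (b - a′) - (b′ - a)
      columnwise m a b b′ a′ c f r s refl = identity m a b b′ a′ c f r
        where
        identity : ∀ m a b b′ a′ c f r → let N = + 4 + m ; s = a + (b + (c + (f + r))) in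
          (N * a - s - (b′ - b)) + ((N * b - s - (a′ - a)) + ((N * c - s) + ((N * f - s) + (m * (- s) + N * r))))
            ≡ (b - a′) - (b′ - a)
        identity = solve-∀

    -- In the sum over a layer the K_n parts cancel. Only the corrections of the edge with voltage
    -- survive, and they form a difference along the cycle.
    column-Δ : ∀ g → column x g ≡ w g - w (next g)
    column-Δ g = begin
      x₀ g + (x₁ g + (x₂ g + (x₃ g + R g)))
        ≡⟨ cong₂ _+_ (x≡ _ g) (cong₂ _+_ (x≡ _ g) (cong₂ _+_ (x≡ _ g) (cong₂ _+_ (x≡ _ g) (R≡ g)))) ⟩
      Δ z 0F g + (Δ z 1F g + (Δ z 2F g + (Δ z 3F g + (+ m * (- column z g) + N * Z g))))
        ≡⟨ columnwise (+ m) (z₀ g) (z₁ g) (z₁ (next g)) (z₀ (prev g)) (z₂ g) (z₃ g) (Z g) (column z g) refl ⟩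
      w g - (z₁ (next g) - z₀ g)
        ≡⟨ cong (λ h → w g - (z₁ (next g) - z₀ h)) (prev-next g) ⟨
      w g - w (next g) ∎

    ∑-column-Δ : sum (column x) ≡ 0ℤ
    ∑-column-Δ = begin
      sum (column x)                    ≡⟨ sum-cong-≗ column-Δ ⟩
      sum (λ g → w g - w (next g))      ≡⟨ ∑-distrib-- w (w ∘ next) ⟩
      sum w - sum (w ∘ next)            ≡⟨ cong (_-_ (sum w)) (∑-next w) ⟩
      sum w - sum w                     ≡⟨ ℤ.+-inverseʳ (sum w) ⟩
      0ℤ                                ∎

    private
      F≡ : ∀ k → F k ≡ - (w 0F - w k)
      F≡ k = cong -_ (trans (prefix-cong column-Δ k) (prefix-telescope w k))

      T-step : ∀ N a b a′ f s → (N * b - s - (a′ - a)) - (N * f - s) ≡ N * (b - f) + (a - a′)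
      T-step = solve-∀

      U-step : ∀ m w0 a b a′ c f r → let N = + 4 + m ; s = a + (b + (c + (f + r))) in
        N * (- (w0 - (b - a′))) - N * (N * b - s - (a′ - a)) - (N * c - s) - (N * f - s)
          - (m * (- s) + N * r) + (N - + 2) * (N * f - s)
        ≡ N * (- w0) - N * (N - + 2) * (b - f)
      U-step = solve-∀

      U-cong : ∀ {N F F′ x₁ x₁′ x₂ x₂′ x₃ x₃′ R R′} →
        F ≡ F′ → x₁ ≡ x₁′ → x₂ ≡ x₂′ → x₃ ≡ x₃′ → R ≡ R′ →
        N * F - N * x₁ - x₂ - x₃ - R + (N - + 2) * x₃ ≡ N * F′ - N * x₁′ - x₂′ - x₃′ - R′ + (N - + 2) * x₃′
      U-cong refl refl refl refl refl = refl

      η-step : ∀ N a b s → (N * a - s) - (N * b - s) ≡ N * (a - b)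
      η-step = solve-∀

    Δ⇒Relation : Relation x
    Δ⇒Relation = record
      -- By telescoping, `F k` is `w k - w 0F`; the constant part of this is `μ`.
      { μ  = - w 0F
      ; p  = p
      ; H  = λ i g → z (4+ i) g - z₃ g
      ; T≡ = begin
          sum (λ g → x₁ g - x₃ g)
            ≡⟨ sum-cong-≗ (λ g → trans (cong₂ _-_ (x≡ 1F g) (x≡ 3F g))
                 (T-step N (z₀ g) (z₁ g) (z₀ (prev g)) (z₃ g) (column z g))) ⟩
          sum (λ g → N * p g + (z₀ g - z₀ (prev g)))
            ≡⟨ ∑-distrib-+ (λ g → N * p g) (λ g → z₀ g - z₀ (prev g)) ⟩
          sum (λ g → N * p g) + sum (λ g → z₀ g - z₀ (prev g))
            ≡⟨ cong₂ _+_ (sym (*-distribˡ-sum N p)) (∑-distrib-- z₀ (z₀ ∘ prev)) ⟩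
          N * sum p + (sum z₀ - sum (z₀ ∘ prev))
            ≡⟨ cong (λ s → N * sum p + (sum z₀ - s)) (∑-prev z₀) ⟩
          N * sum p + (sum z₀ - sum z₀)
            ≡⟨ cong (_+_ (N * sum p)) (ℤ.+-inverseʳ (sum z₀)) ⟩
          N * sum p + 0ℤ
            ≡⟨ ℤ.+-identityʳ (N * sum p) ⟩
          N * sum p ∎
      ; U≡ = λ k → trans (U-cong {N} (F≡ k) (x≡ 1F k) (x≡ 2F k) (x≡ 3F k) (R≡ k))
          (U-step (+ m) (w 0F) (z₀ k) (z₁ k) (z₀ (prev k)) (z₂ k) (z₃ k) (Z k))
      ; η≡ = λ i g → trans (cong₂ _-_ (x≡ (4+ i) g) (x≡ 3F g))
          (η-step N (z (4+ i) g) (z₃ g) (column z g))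
      }

  module _ (x : Field) (∑x≡0 : sum (column x) ≡ 0ℤ) (rel : Relation x) where
    open Coordinates x
    open Relation rel
    -- Row 1F of x = Δ z prescribes the cyclic differences of z₀, which sum to 0 by T≡.  Row 3F
    -- expresses the column sums of z through q = z₃, and then U≡ and row 2F yield z₁ = q + p.
    private
      f Y z₀ z₁ q h z₂ : Vector ℤ d
      f g  = x₁ g - x₃ g - N * p g
      Y    = prefix f
      z₀ g = Y g + f g
      -- For a solution, `column x` is the cyclic difference of `z₁ g - z₀ (prev g)`, which is
      -- therefore `F` up to the constant `- μ`; here `Y g` plays the role of `z₀ (prev g)`.
      z₁ g = Y g + F g - μ
      q g  = z₁ g - p g
      h g  = sum (λ i → H i g)
      -- Solved from the column sum `N * q g - x₃ g` that row `3F` demands.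
      z₂ g = + 2 * q g - x₃ g - z₀ g - p g - h g

      z : Field
      z 0F     = z₀
      z 1F     = z₁
      z 2F     = z₂
      z 3F     = q
      z (4+ i) = λ g → q g + H i g

      ∑f≡0 : sum f ≡ 0ℤ
      ∑f≡0 = begin
        sum f                     ≡⟨ ∑-distrib-- (λ g → x₁ g - x₃ g) (λ g → N * p g) ⟩
        T - sum (λ g → N * p g)   ≡⟨ cong₂ _-_ T≡ (sym (*-distribˡ-sum N p)) ⟩
        N * sum p - N * sum p     ≡⟨ ℤ.+-inverseʳ (N * sum p) ⟩
        0ℤ                        ∎

      z₀-prev : ∀ g → z₀ (prev g) ≡ Y g
      z₀-prev g = trans (sym (prefix-next f ∑f≡0 (prev g))) (cong Y (next-prev g))

      z₁-next : ∀ g → z₁ (next g) ≡ (Y g + f g) + - (prefix (column x) g + column x g) - μ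
      z₁-next g = cong₂ (λ a b → a + - b - μ) (prefix-next f ∑f≡0 g) (prefix-next (column x) ∑x≡0 g)

      column-step : ∀ m z₀ p q x₃ h → let N = + 4 + m in
        z₀ + ((q + p) + ((+ 2 * q - x₃ - z₀ - p - h) + (q + (m * q + 1ℤ * h)))) ≡ N * q - x₃
      column-step = solve-∀

      restore : ∀ a b → a ≡ a - b + b
      restore = solve-∀

      column≡ : ∀ g → column z g ≡ N * q g - x₃ g
      column≡ g = begin
        z₀ g + (z₁ g + (z₂ g + (q g + sum (λ i → q g + H i g))))
          ≡⟨ cong₂ (λ a b → z₀ g + (a + (z₂ g + (q g + b)))) (restore (z₁ g) (p g))
               (trans (sum-cong-≗ (λ i → cong (_+_ (q g)) (sym (ℤ.*-identityˡ (H i g)))))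
                 (∑-affine (q g) 1ℤ (λ i → H i g))) ⟩
        z₀ g + ((q g + p g) + (z₂ g + (q g + (+ m * q g + 1ℤ * h g))))
          ≡⟨ column-step (+ m) (z₀ g) (p g) (q g) (x₃ g) (h g) ⟩
        N * q g - x₃ g ∎

      R≡ : ∀ g → R g ≡ + m * x₃ g + N * h g
      R≡ g = trans (sum-cong-≗ (λ i → trans (i≡j+[i-j] (x (4+ i) g) (x₃ g)) (cong (_+_ (x₃ g)) (η≡ i g))))
        (∑-affine (x₃ g) N (λ i → H i g))

      step₀ : ∀ N Y Pc x₀ x₁ x₂ x₃ R p μ →
        let f = x₁ - x₃ - N * p
            c = x₀ + (x₁ + (x₂ + (x₃ + R)))
            q = Y + - Pc - μ - p in
        x₀ - (N * (Y + f) - (N * q - x₃) - (((Y + f) + - (Pc + c) - μ) - (Y + - Pc - μ)))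
          ≡ (N * (- Pc) - N * x₁ - x₂ - x₃ - R + (N - + 2) * x₃) - (N * μ - N * (N - + 2) * p)
      step₀ = solve-∀

      step₁ : ∀ N Y Q p x₁ x₃ → x₁ ≡ N * Q - (N * (Q - p) - x₃) - (Y - (Y + (x₁ - x₃ - N * p)))
      step₁ = solve-∀

      step₂ : ∀ m Y F x₁ x₂ x₃ h p μ →
        let N = + 4 + m
            f = x₁ - x₃ - N * p
            q = Y + F - μ - p in
        (N * (+ 2 * q - x₃ - (Y + f) - p - h) - (N * q - x₃)) - x₂
          ≡ (N * F - N * x₁ - x₂ - x₃ - (m * x₃ + N * h) + (N - + 2) * x₃) - (N * μ - N * (N - + 2) * p)
      step₂ = solve-∀

      step₃ : ∀ a b → b ≡ a - (a - b)
      step₃ = solve-∀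

      step₄ : ∀ N q x₃ h → x₃ + N * h ≡ N * (q + h) - (N * q - x₃)
      step₄ = solve-∀

      solution : ∀ i g → x i g ≡ Δ z i g
      solution 0F g = trans
        (≡-by-difference (U≡ g) (step₀ N (Y g) (prefix (column x) g) (x₀ g) (x₁ g) (x₂ g) (x₃ g) (R g) (p g) μ))
        (sym (cong₂ (λ c b → N * z₀ g - c - (b - z₁ g)) (column≡ g) (z₁-next g)))
      solution 1F g = trans
        (step₁ N (Y g) (z₁ g) (p g) (x₁ g) (x₃ g))
        (sym (cong₂ (λ c a → N * z₁ g - c - (a - z₀ g)) (column≡ g) (z₀-prev g)))
      solution 2F g = trans
        (sym (≡-by-difference
          (trans (cong (λ r → N * F g - N * x₁ g - x₂ g - x₃ g - r + (N - + 2) * x₃ g) (sym (R≡ g))) (U≡ g))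
          (step₂ (+ m) (Y g) (F g) (x₁ g) (x₂ g) (x₃ g) (h g) (p g) μ)))
        (sym (cong (λ c → N * z₂ g - c) (column≡ g)))
      solution 3F g = trans
        (step₃ (N * q g) (x₃ g))
        (sym (cong (λ c → N * q g - c) (column≡ g)))
      solution (4+ i) g = begin
        x (4+ i) g                              ≡⟨ i≡j+[i-j] (x (4+ i) g) (x₃ g) ⟩
        x₃ g + η i g                            ≡⟨ cong (_+_ (x₃ g)) (η≡ i g) ⟩
        x₃ g + N * H i g                        ≡⟨ step₄ N (q g) (x₃ g) (H i g) ⟩
        N * (q g + H i g) - (N * q g - x₃ g)    ≡⟨ cong (λ c → N * (q g + H i g) - c) (column≡ g) ⟨
        N * (q g + H i g) - column z g          ∎

    Relation⇒Δ : ∃ λ z → ∀ i g → x i g ≡ Δ z i g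
    Relation⇒Δ = z , solution

module _ {k : ℕ} {z : ℤ} where

  ∣⇒≈0 : + k ℤ∣.∣ z → AbelianGroup._≈_ (ℤ/ k) z 0ℤ
  ∣⇒≈0 = subst (+ k ℤ∣.∣_) (sym (ℤ.+-identityʳ z))

  ≈0⇒∣ : AbelianGroup._≈_ (ℤ/ k) z 0ℤ → + k ℤ∣.∣ z
  ≈0⇒∣ = subst (+ k ℤ∣.∣_) (ℤ.+-identityʳ z)

combine-elim : ∀ {n d p} {P : Fin (n ℕ.* d) → Set p} → (∀ i g → P (combine {n} {d} i g)) → ∀ x → P x
combine-elim {n} {d} {P = P} Pc x = subst P (Fin.combine-remQuot {n} d x) (Pc _ _)

-- Diagonalising the relations

module SingleVoltageJacobian (m k : ℕ) where
  open import Data.Integer.Base using (_+_; _*_; _-_; -_)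
  open ≡-Reasoning
  open SingleVoltage m (2 ℕ.+ k)

  Q D : ℤ
  Q = N - + 2
  D = + 3 + + k

  -- The coordinates with respect to t - (n-2) u_1, Σ_k u_k, u_k - u_1 (k ≥ 2) and u_1.
  module InvariantCoordinates (x : Field) where
    open Coordinates x public

    ω : Vector ℤ (1 ℕ.+ k)
    ω i = U (suc (suc i)) - U 0F

    -- The generator u_0 is replaced by the sum, through u_0 = Σ_k u_k - Σ_{k≥2} (u_k - u_1) - (d-1)
    -- u_1. So `U 0F` is the coordinate at the sum, and `κ` collects what falls on u_1: `Q * T` from
    -- t, every U_k with k ≥ 1, and -(d-1) times `U 0F`.
    κ : ℤ
    κ = Q * T + sum U - D * U 0F

  record Divisible (x : Field) : Set where
    open InvariantCoordinates x
    field
      N∣T  : N ℤ∣.∣ T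
      N∣U₀ : N ℤ∣.∣ U 0F
      N∣η  : ∀ i g → N ℤ∣.∣ η i g
      NQ∣ω : ∀ i → N * Q ℤ∣.∣ ω i
      DNQ∣κ : D * N * Q ℤ∣.∣ κ

  module _ {x : Field} where
    open InvariantCoordinates x

    Relation⇒Divisible : Relation x → Divisible x
    Relation⇒Divisible rel = record
      { N∣T  = divides (sum p) (trans T≡ (ℤ.*-comm N (sum p)))
      ; N∣U₀ = divides (μ - Q * p 0F) (trans (U≡ 0F) (U₀-step N Q μ (p 0F)))
      ; N∣η  = λ i g → divides (H i g) (trans (η≡ i g) (ℤ.*-comm N (H i g)))
      ; NQ∣ω = λ i → divides (p 0F - p (suc (suc i)))
          (trans (cong₂ _-_ (U≡ (suc (suc i))) (U≡ 0F)) (ω-step N Q μ (p 0F) (p (suc (suc i)))))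
      ; DNQ∣κ = divides (p 0F) (begin
          Q * T + sum U - D * U 0F
            ≡⟨ cong₂ (λ t u → Q * t + sum U - D * u) T≡ (U≡ 0F) ⟩
          Q * (N * sum p) + sum U - D * (N * μ - N * Q * p 0F)
            ≡⟨ cong (λ s → Q * (N * sum p) + s - D * (N * μ - N * Q * p 0F)) ∑U≡ ⟩
          Q * (N * sum p) + (D * (N * μ) + - (N * Q) * sum p) - D * (N * μ - N * Q * p 0F)
            ≡⟨ κ-step N Q D μ (sum p) (p 0F) ⟩
          p 0F * (D * N * Q) ∎)
      }
      where
      open Relation rel

      U₀-step : ∀ N Q μ p → N * μ - N * Q * p ≡ (μ - Q * p) * N
      U₀-step = solve-∀

      ω-step : ∀ N Q μ p p′ → (N * μ - N * Q * p′) - (N * μ - N * Q * p) ≡ (p - p′) * (N * Q)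
      ω-step = solve-∀

      κ-step : ∀ N Q D μ s p →
        Q * (N * s) + (D * (N * μ) + - (N * Q) * s) - D * (N * μ - N * Q * p) ≡ p * (D * N * Q)
      κ-step = solve-∀

      sign : ∀ a b p → a - b * p ≡ a + - b * p
      sign = solve-∀

      ∑U≡ : sum U ≡ D * (N * μ) + - (N * Q) * sum p
      ∑U≡ = trans (sum-cong-≗ (λ g → trans (U≡ g) (sign (N * μ) (N * Q) (p g)))) (∑-affine (N * μ) (- (N * Q)) p)

    -- The quotient of `κ` gives `p 0F`, those of `ω` give the entries from index 2 on, and `p 1F`
    -- is left to satisfy the equation for `T`. The equation at `U 1F` is then the only one that is
    -- not immediate.
    Divisible⇒Relation : Divisible x → Relation x
    Divisible⇒Relation record { N∣T = divides τ T≡ ; N∣U₀ = divides s U₀≡ ; N∣η = N∣η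
                              ; NQ∣ω = NQ∣ω ; DNQ∣κ = divides c κ≡ } = record
      -- Forced by the relation at index 0, where `U 0F` is `s * N` and `p 0F` is `c`.
      { μ  = s + Q * c
      ; p  = p
      ; H  = λ i g → ℤ∣._∣_.quotient (N∣η i g)
      ; T≡ = trans T≡ (trans (cong (_* N) τ≡) (ℤ.*-comm (sum p) N))
      ; U≡ = U≡
      ; η≡ = λ i g → trans (ℤ∣._∣_.equality (N∣η i g)) (ℤ.*-comm (ℤ∣._∣_.quotient (N∣η i g)) N)
      }
      where
      r : Vector ℤ (1 ℕ.+ k)
      r i = ℤ∣._∣_.quotient (NQ∣ω i)

      p : Vector ℤ d
      p 0F            = c
      -- The value for which the entries of `p` sum to `τ`, the quotient of `T` by `N`.
      p 1F            = c - (D * c - τ - sum r)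
      p (suc (suc i)) = c + -1ℤ * r i

      τ≡ : τ ≡ sum p
      τ≡ = trans (identity (+ k) c τ (sum r))
        (cong (λ y → c + ((c - (D * c - τ - sum r)) + y)) (sym (∑-affine c -1ℤ r)))
        where
        identity : ∀ k c τ r → τ ≡ c + ((c - ((+ 3 + k) * c - τ - r)) + ((1ℤ + k) * c + -1ℤ * r))
        identity = solve-∀

      U-tail : ∀ i → U (suc (suc i)) ≡ U 0F + N * Q * r i
      U-tail i = trans (i≡j+[i-j] (U (suc (suc i))) (U 0F))
        (cong (_+_ (U 0F)) (trans (ℤ∣._∣_.equality (NQ∣ω i)) (ℤ.*-comm (r i) (N * Q))))

      U₁-step : ∀ k N Q τ s c r u →
        let D = + 3 + k in
        u - (N * (s + Q * c) - N * Q * (c - (D * c - τ - r)))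
          ≡ (Q * (τ * N) + (s * N + (u + ((1ℤ + k) * (s * N) + N * Q * r))) - D * (s * N)) - c * (D * N * Q)
      U₁-step = solve-∀

      U₁-hyp : Q * (τ * N) + (s * N + (U 1F + ((1ℤ + + k) * (s * N) + N * Q * sum r))) - D * (s * N)
               ≡ c * (D * N * Q)
      U₁-hyp = begin
        Q * (τ * N) + (s * N + (U 1F + ((1ℤ + + k) * (s * N) + N * Q * sum r))) - D * (s * N)
          ≡⟨ cong₂ (λ t u → Q * t + (u + (U 1F + ((1ℤ + + k) * u + N * Q * sum r))) - D * u) (sym T≡) (sym U₀≡) ⟩
        Q * T + (U 0F + (U 1F + ((1ℤ + + k) * U 0F + N * Q * sum r))) - D * U 0F
          ≡⟨ cong (λ y → Q * T + (U 0F + (U 1F + y)) - D * U 0F)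
               (trans (sym (∑-affine (U 0F) (N * Q) r)) (sym (sum-cong-≗ U-tail))) ⟩
        κ ≡⟨ κ≡ ⟩
        c * (D * N * Q) ∎

      U≡ : ∀ g → U g ≡ N * (s + Q * c) - N * Q * p g
      U≡ 0F = trans U₀≡ (identity N Q s c)
        where
        identity : ∀ N Q s c → s * N ≡ N * (s + Q * c) - N * Q * c
        identity = solve-∀
      -- `U 1F` enters `κ` only through `sum U`, with coefficient 1; once all other terms are known,
      -- `κ≡` is an equation for it.
      U≡ 1F = ≡-by-difference U₁-hyp (U₁-step (+ k) N Q τ s c (sum r) (U 1F))
      U≡ (suc (suc i)) = trans (U-tail i) (trans (cong (_+ N * Q * r i) U₀≡) (identity N Q s c (r i)))
        where
        identity : ∀ N Q s c r → s * N + N * Q * r ≡ N * (s + Q * c) - N * Q * (c + -1ℤ * r)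
        identity = solve-∀

  -- The map onto the direct sum of cyclic groups

  Target : AbelianGroup 0ℓ 0ℓ
  Target = (ℤ/ n) ^^ (m ℕ.* d ℕ.+ 2) ⊕ (ℤ/ (n ℕ.* (n ℕ.∸ 2))) ^^ (1 ℕ.+ k) ⊕ ℤ/ (d ℕ.* n ℕ.* (n ℕ.∸ 2))

  private
    module Target = AbelianGroup Target

    -- All coordinates that matter modulo `n`: the (n-4)d entries of `η`, and the two coordinates at
    -- t - (n-2) u_1 and Σ_k u_k, which account for the 2 in the exponent.
    torsion : Field → Vector ℤ (m ℕ.* d ℕ.+ 2)
    torsion x = (λ t → uncurry η (remQuot {m} d t)) Vector.++ (T Vector.∷ U 0F Vector.∷ Vector.[])
      where open Coordinates x

    η-index : Fin m → Fin d → Fin (m ℕ.* d ℕ.+ 2)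
    η-index i g = combine i g ↑ˡ 2

    T-index U-index : Fin (m ℕ.* d ℕ.+ 2)
    T-index = m ℕ.* d ↑ʳ 0F
    U-index = m ℕ.* d ↑ʳ 1F

    index-elim : (P : Fin (m ℕ.* d ℕ.+ 2) → Set) →
                 (∀ i g → P (η-index i g)) → P T-index → P U-index → ∀ t → P t
    index-elim P Pη PT PU t with splitAt (m ℕ.* d) t in eq
    ... | inj₁ u  = subst P (Fin.splitAt⁻¹-↑ˡ eq) (combine-elim {m} {d} {P = λ u → P (u ↑ˡ 2)} Pη u)
    ... | inj₂ 0F = subst P (Fin.splitAt⁻¹-↑ʳ {m ℕ.* d} eq) PT
    ... | inj₂ 1F = subst P (Fin.splitAt⁻¹-↑ʳ {m ℕ.* d} eq) PU

    module _ (x : Field) where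
      open Coordinates x

      torsion-η : ∀ i g → torsion x (η-index i g) ≡ η i g
      torsion-η i g = trans
        (lookup-++ˡ (λ t → uncurry η (remQuot {m} d t)) (T Vector.∷ U 0F Vector.∷ Vector.[]) (combine i g))
        (cong (uncurry η) (Fin.remQuot-combine i g))

      torsion-T : torsion x T-index ≡ T
      torsion-T = lookup-++ʳ (λ t → uncurry η (remQuot {m} d t)) (T Vector.∷ U 0F Vector.∷ Vector.[]) 0F

      torsion-U : torsion x U-index ≡ U 0F
      torsion-U = lookup-++ʳ (λ t → uncurry η (remQuot {m} d t)) (T Vector.∷ U 0F Vector.∷ Vector.[]) 1F

    Φ : Field → Target.Carrier
    Φ x = torsion x , InvariantCoordinates.ω x , InvariantCoordinates.κ x

    pos-NQ : + (n ℕ.* (n ℕ.∸ 2)) ≡ N * Q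
    pos-NQ = ℤ.pos-* n (n ℕ.∸ 2)

    pos-DNQ : + (d ℕ.* n ℕ.* (n ℕ.∸ 2)) ≡ D * N * Q
    pos-DNQ = trans (ℤ.pos-* (d ℕ.* n) (n ℕ.∸ 2)) (cong (_* Q) (ℤ.pos-* d n))

    Divisible⇒Φ≈ε : ∀ {x} → Divisible x → Φ x Target.≈ Target.ε
    Divisible⇒Φ≈ε {x} div =
        index-elim (λ t → AbelianGroup._≈_ (ℤ/ n) (torsion x t) 0ℤ)
          (λ i g → ∣⇒≈0 (subst (N ℤ∣.∣_) (sym (torsion-η x i g)) (N∣η i g)))
          (∣⇒≈0 (subst (N ℤ∣.∣_) (sym (torsion-T x)) N∣T))
          (∣⇒≈0 (subst (N ℤ∣.∣_) (sym (torsion-U x)) N∣U₀))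
      , (λ i → ∣⇒≈0 (subst (ℤ∣._∣ InvariantCoordinates.ω x i) (sym pos-NQ) (NQ∣ω i)))
      , ∣⇒≈0 (subst (ℤ∣._∣ InvariantCoordinates.κ x) (sym pos-DNQ) DNQ∣κ)
      where open Divisible div

    Φ≈ε⇒Divisible : ∀ {x} → Φ x Target.≈ Target.ε → Divisible x
    Φ≈ε⇒Divisible {x} (t≈0 , ω≈0 , κ≈0) = record
      { N∣T   = subst (N ℤ∣.∣_) (torsion-T x) (≈0⇒∣ (t≈0 T-index))
      ; N∣U₀  = subst (N ℤ∣.∣_) (torsion-U x) (≈0⇒∣ (t≈0 U-index))
      ; N∣η   = λ i g → subst (N ℤ∣.∣_) (torsion-η x i g) (≈0⇒∣ (t≈0 (η-index i g)))
      ; NQ∣ω  = λ i → subst (ℤ∣._∣ InvariantCoordinates.ω x i) pos-NQ (≈0⇒∣ (ω≈0 i))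
      ; DNQ∣κ = subst (ℤ∣._∣ InvariantCoordinates.κ x) pos-DNQ (≈0⇒∣ κ≈0)
      }

    module _ {x y z : Field} (z≡ : ∀ i g → z i g ≡ x i g + y i g) where
      private
        module X = InvariantCoordinates x
        module Y = InvariantCoordinates y
        module Z = InvariantCoordinates z

        medial-- : ∀ a b c e → (a + b) - (c + e) ≡ (a - c) + (b - e)
        medial-- = solve-∀

        T-+ : Z.T ≡ X.T + Y.T
        T-+ = trans
          (sum-cong-≗ (λ g → trans (cong₂ _-_ (z≡ 1F g) (z≡ 3F g))
            (medial-- (X.x₁ g) (Y.x₁ g) (X.x₃ g) (Y.x₃ g))))
          (∑-distrib-+ (λ g → X.x₁ g - X.x₃ g) (λ g → Y.x₁ g - Y.x₃ g))

        R-+ : ∀ g → Z.R g ≡ X.R g + Y.R g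
        R-+ g = trans (sum-cong-≗ (λ i → z≡ (4+ i) g)) (∑-distrib-+ (λ i → x (4+ i) g) (λ i → y (4+ i) g))

        F-+ : ∀ g → Z.F g ≡ X.F g + Y.F g
        F-+ g = trans
          (cong -_ (trans
            (prefix-cong (λ h → trans (sum-cong-≗ (λ i → z≡ i h)) (∑-distrib-+ (λ i → x i h) (λ i → y i h))) g)
            (prefix-+ (column x) (column y) g)))
          (ℤ.neg-distrib-+ (prefix (column x) g) (prefix (column y) g))

        U-step : ∀ {N Q F x₁ x₂ x₃ R} F′ x₁′ x₂′ x₃′ R′ F″ x₁″ x₂″ x₃″ R″ →
          F ≡ F′ + F″ → x₁ ≡ x₁′ + x₁″ → x₂ ≡ x₂′ + x₂″ → x₃ ≡ x₃′ + x₃″ → R ≡ R′ + R″ →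
          N * F - N * x₁ - x₂ - x₃ - R + Q * x₃ ≡
            (N * F′ - N * x₁′ - x₂′ - x₃′ - R′ + Q * x₃′) + (N * F″ - N * x₁″ - x₂″ - x₃″ - R″ + Q * x₃″)
        U-step {N} {Q} F′ x₁′ x₂′ x₃′ R′ F″ x₁″ x₂″ x₃″ R″ refl refl refl refl refl =
          identity N Q F′ x₁′ x₂′ x₃′ R′ F″ x₁″ x₂″ x₃″ R″
          where
          identity : ∀ N Q F′ x₁′ x₂′ x₃′ R′ F″ x₁″ x₂″ x₃″ R″ →
            N * (F′ + F″) - N * (x₁′ + x₁″) - (x₂′ + x₂″) - (x₃′ + x₃″) - (R′ + R″) + Q * (x₃′ + x₃″) ≡
            (N * F′ - N * x₁′ - x₂′ - x₃′ - R′ + Q * x₃′) + (N * F″ - N * x₁″ - x₂″ - x₃″ - R″ + Q * x₃″)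
          identity = solve-∀

        U-+ : ∀ g → Z.U g ≡ X.U g + Y.U g
        U-+ g = U-step {N} {Q} (X.F g) (X.x₁ g) (X.x₂ g) (X.x₃ g) (X.R g)
          (Y.F g) (Y.x₁ g) (Y.x₂ g) (Y.x₃ g) (Y.R g)
          (F-+ g) (z≡ 1F g) (z≡ 2F g) (z≡ 3F g) (R-+ g)

        η-+ : ∀ i g → Z.η i g ≡ X.η i g + Y.η i g
        η-+ i g = trans (cong₂ _-_ (z≡ (4+ i) g) (z≡ 3F g)) (medial-- (x (4+ i) g) (y (4+ i) g) (X.x₃ g) (Y.x₃ g))

        κ-+ : Z.κ ≡ X.κ + Y.κ
        κ-+ = begin
          Q * Z.T + sum Z.U - D * Z.U 0F
            ≡⟨ cong₂ (λ t s → Q * t + s - D * Z.U 0F) T-+ (trans (sum-cong-≗ U-+) (∑-distrib-+ X.U Y.U)) ⟩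
          Q * (X.T + Y.T) + (sum X.U + sum Y.U) - D * Z.U 0F
            ≡⟨ cong (λ u → Q * (X.T + Y.T) + (sum X.U + sum Y.U) - D * u) (U-+ 0F) ⟩
          Q * (X.T + Y.T) + (sum X.U + sum Y.U) - D * (X.U 0F + Y.U 0F)
            ≡⟨ identity Q D X.T Y.T (sum X.U) (sum Y.U) (X.U 0F) (Y.U 0F) ⟩
          X.κ + Y.κ ∎
          where
          identity : ∀ Q D t t′ s s′ u u′ →
            Q * (t + t′) + (s + s′) - D * (u + u′) ≡ (Q * t + s - D * u) + (Q * t′ + s′ - D * u′)
          identity = solve-∀

      Φ-+ : Φ z Target.≈ Φ x Target.∙ Φ y
      Φ-+ =
          index-elim (λ t → AbelianGroup._≈_ (ℤ/ n) (torsion z t) (torsion x t + torsion y t))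
            (λ i g → AbelianGroup.reflexive (ℤ/ n) (trans (torsion-η z i g)
              (trans (η-+ i g) (sym (cong₂ _+_ (torsion-η x i g) (torsion-η y i g))))))
            (AbelianGroup.reflexive (ℤ/ n) (trans (torsion-T z)
              (trans T-+ (sym (cong₂ _+_ (torsion-T x) (torsion-T y))))))
            (AbelianGroup.reflexive (ℤ/ n) (trans (torsion-U z)
              (trans (U-+ 0F) (sym (cong₂ _+_ (torsion-U x) (torsion-U y))))))
        , (λ i → AbelianGroup.reflexive (ℤ/ (n ℕ.* (n ℕ.∸ 2)))
            (trans (cong₂ _-_ (U-+ (suc (suc i))) (U-+ 0F))
              (medial-- (X.U (suc (suc i))) (Y.U (suc (suc i))) (X.U 0F) (Y.U 0F))))
        , AbelianGroup.reflexive (ℤ/ (d ℕ.* n ℕ.* (n ℕ.∸ 2))) κ-+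

    -- Additivity is stated for a field that equals a sum only pointwise, so congruence is a case of
    -- it: both `x` and `y` are pointwise `y` plus the zero field.
    Φ-cong : ∀ {x y : Field} → (∀ i g → x i g ≡ y i g) → Φ x Target.≈ Φ y
    Φ-cong {x} {y} x≡y = Target.trans {Φ x} {Φ y Target.∙ Φ 0-field} {Φ y}
      (Φ-+ {y} {0-field} {x} (λ i g → trans (x≡y i g) (sym (ℤ.+-identityʳ (y i g)))))
      (Target.sym {Φ y} {Φ y Target.∙ Φ 0-field} (Φ-+ {y} {0-field} {y} (λ i g → sym (ℤ.+-identityʳ (y i g)))))
      where
      0-field : Field
      0-field _ _ = 0ℤ

    -- Since t is the class of b_0 - a_{d-1} = b_0 + (n-1) a_0 - n c_0, the divisor with coordinates
    -- t, u, H is Σ_k u_k (a_k - c_k) + t (b_0 + (n-1) a_0 - n c_0) + Σ H_{i,g} (v_{i,g} - c_g).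
    module Lift (v : Vector ℤ (m ℕ.* d ℕ.+ 2)) (w : Vector ℤ (1 ℕ.+ k)) (c : ℤ) where
      t s : ℤ
      t = v T-index
      s = v U-index

      H : Vector ℤ d
      H g = sum (λ i → v (η-index i g))

      u τ : Vector ℤ d
      u 0F            = s
      -- Makes `κ` equal to `c`; the entry at index 1 occurs in `κ` exactly once, inside the sum of
      -- `U`.
      u 1F            = c - Q * t + D * s - s - sum (λ i → w i + s)
      u (suc (suc i)) = w i + s
      τ 0F      = t
      τ (suc _) = 0ℤ

      x : Field
      x 0F     g = u g + (N - 1ℤ) * τ g
      x 1F     g = τ g
      x 2F     g = - u g - N * τ g - H g
      x 3F     g = 0ℤ
      x (4+ i) g = v (η-index i g)

      open InvariantCoordinates x

      -- With every layer of degree 0 the partial sums `F` vanish, and `U` reduces to the prescribed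
      -- `u`.
      column≡0 : ∀ g → column x g ≡ 0ℤ
      column≡0 g = identity N (u g) (τ g) (H g)
        where
        identity : ∀ N u t h → (u + (N - 1ℤ) * t) + (t + ((- u - N * t - h) + (0ℤ + h))) ≡ 0ℤ
        identity = solve-∀

      ∑-column≡0 : sum (column x) ≡ 0ℤ
      ∑-column≡0 = trans (sum-cong-≗ column≡0) (sum-replicate-zero d)

      T≡ : T ≡ t
      T≡ = trans (cong (_+_ (t - 0ℤ)) (sum-replicate-zero (2 ℕ.+ k))) (identity t)
        where
        identity : ∀ t → t - 0ℤ + 0ℤ ≡ t
        identity = solve-∀

      U≡ : ∀ g → U g ≡ u g
      U≡ g = trans
        (cong (λ f → N * (- f) - N * τ g - x₂ g - 0ℤ - H g + Q * 0ℤ) (prefix-0 column≡0 g))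
        (identity N Q (u g) (τ g) (H g))
        where
        identity : ∀ N Q u t h → N * (- 0ℤ) - N * t - (- u - N * t - h) - 0ℤ - h + Q * 0ℤ ≡ u
        identity = solve-∀

      Φ-lift : Φ x Target.≈ (v , w , c)
      Φ-lift =
          index-elim (λ j → AbelianGroup._≈_ (ℤ/ n) (torsion x j) (v j))
            (λ i g → AbelianGroup.reflexive (ℤ/ n) (trans (torsion-η x i g) (ℤ.+-identityʳ (v (η-index i g)))))
            (AbelianGroup.reflexive (ℤ/ n) (trans (torsion-T x) T≡))
            (AbelianGroup.reflexive (ℤ/ n) (trans (torsion-U x) (U≡ 0F)))
        , (λ i → AbelianGroup.reflexive (ℤ/ (n ℕ.* (n ℕ.∸ 2)))
            (trans (cong₂ _-_ (U≡ (suc (suc i))) (U≡ 0F)) (ω-identity (w i) s)))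
        , AbelianGroup.reflexive (ℤ/ (d ℕ.* n ℕ.* (n ℕ.∸ 2))) (begin
            Q * T + sum U - D * U 0F    ≡⟨ cong₂ (λ a b → Q * a + b - D * U 0F) T≡ (sum-cong-≗ U≡) ⟩
            Q * t + sum u - D * U 0F    ≡⟨ cong (λ a → Q * t + sum u - D * a) (U≡ 0F) ⟩
            Q * t + sum u - D * s       ≡⟨ κ-identity Q D t s c (sum (λ i → w i + s)) ⟩
            c                           ∎)
        where
        ω-identity : ∀ w s → w + s - s ≡ w
        ω-identity = solve-∀

        κ-identity : ∀ Q D t s c r → Q * t + (s + ((c - Q * t + D * s - s - r) + r)) - D * s ≡ c
        κ-identity = solve-∀

  -- The Jacobian of the single voltage cover

  private
    L : Matrix (n ℕ.* d) (n ℕ.* d)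
    L = laplacian (singleVoltageCover n d)

    L-const : ∀ z y → sum (λ j → L y j * z) ≡ 0ℤ
    L-const z = combine-elim {n} {d} {P = λ y → sum (λ j → L y j * z) ≡ 0ℤ} λ i g →
      trans (laplacian≡Δ (λ _ → z) i g) (Δ-const i g)
      where
      zero-row : N * z - sum {n} (λ _ → z) ≡ 0ℤ
      zero-row = trans (cong (_-_ (N * z)) (∑-const n z)) (ℤ.+-inverseʳ (N * z))

      Δ-const : ∀ i g → Δ (λ _ _ → z) i g ≡ 0ℤ
      Δ-const 0F            g = cong₂ _-_ zero-row (ℤ.+-inverseʳ z)
      Δ-const 1F            g = cong₂ _-_ zero-row (ℤ.+-inverseʳ z)
      Δ-const (suc (suc i)) g = zero-row

    toField : Vector ℤ (n ℕ.* d) → Field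
    toField y i g = y (combine i g)

    ∑-toField : ∀ y → sum (column (toField y)) ≡ sum y
    ∑-toField y = trans (sym (∑-comm (toField y))) (sym (∑-combine n d y))

    L-sum : ∀ z → sum (L *ᵥ z) ≡ 0ℤ
    L-sum z = trans (sym (∑-toField (L *ᵥ z))) (∑-column-Δ (toField (L *ᵥ z)) (toField z) (laplacian≡Δ z))

  module _ (v : Fin (n ℕ.* d)) where
    private
      J : AbelianGroup 0ℓ 0ℓ
      J = Jacobian (singleVoltageCover n d) v

      module J = AbelianGroup J

      field-of : J.Carrier → Field
      field-of y = toField (balance v y)

    Jacobian≅Target : J ≅ Target
    Jacobian≅Target = ≅-intro {A = J} {B = Target} (λ y → Φ (field-of y))
      (λ y y′ → Φ-+ {field-of y} {field-of y′} (λ i g → balance-+ v y y′ (combine i g)))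
      ker⁺ ker⁻ onto
      where
      ker⁺ : ∀ y → y J.≈ J.ε → Φ (field-of y) Target.≈ Target.ε
      ker⁺ y y≈ε =
        let z , y≡ = delete-image⁺ v L L-const L-sum
                       (Subgroup.resp (image (delete L v)) (λ j → ℤ.+-identityʳ (y j)) y≈ε)
        in Divisible⇒Φ≈ε {field-of y} (Relation⇒Divisible {field-of y} (Δ⇒Relation (field-of y) (toField z)
             (λ i g → trans (y≡ (combine i g)) (laplacian≡Δ z i g))))

      ker⁻ : ∀ y → Φ (field-of y) Target.≈ Target.ε → y J.≈ J.ε
      ker⁻ y Φ≈ε =
        let z , y≡ = Relation⇒Δ (field-of y) (trans (∑-toField (balance v y)) (balance-sum v y))
                       (Divisible⇒Relation {field-of y} (Φ≈ε⇒Divisible {field-of y} Φ≈ε))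
            w : Vector ℤ (n ℕ.* d)
            w = λ t → uncurry z (remQuot {n} d t)
        in Subgroup.resp (image (delete L v)) (λ j → sym (ℤ.+-identityʳ (y j)))
             (delete-image⁻ v L L-const L-sum w
               (combine-elim {n} {d} {P = λ t → balance v y t ≡ (L *ᵥ w) t} λ i g →
                 trans (y≡ i g) (trans (Δ-cong (λ j h → sym (cong (uncurry z) (Fin.remQuot-combine j h))) i g)
                   (sym (laplacian≡Δ w i g)))))

      onto : ∀ y → ∃ λ x → Φ (field-of x) Target.≈ y
      onto (a , b , c) = y , Target.trans {Φ (field-of y)} {Φ x} {a , b , c}
        (Φ-cong {field-of y} {x} λ i g →
          trans (balance-punchIn⁻ v X ∑X≡0 (combine i g)) (toField-X i g)) Φ-lift
        where
        open Lift a b c using (x; ∑-column≡0; Φ-lift)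

        X : Vector ℤ (n ℕ.* d)
        X t = uncurry x (remQuot {n} d t)

        toField-X : ∀ i g → toField X i g ≡ x i g
        toField-X i g = cong (uncurry x) (Fin.remQuot-combine i g)

        ∑X≡0 : sum X ≡ 0ℤ
        ∑X≡0 = trans (sym (∑-toField X))
          (trans (sum-cong-≗ (λ g → sum-cong-≗ (λ i → toField-X i g))) ∑-column≡0)

        y : J.Carrier
        y = X ∘ punchIn v

-- Invariant factors

Linked-∷ : ∀ {k ds} → All (k ℕ∣.∣_) ds → Linked ℕ∣._∣_ ds → Linked ℕ∣._∣_ (k ∷ ds)
Linked-∷ []          _      = [-]
Linked-∷ (k∣d ∷ _) linked = k∣d ∷ linked

Linked-replicate-++ : ∀ {k ds} m → All (k ℕ∣.∣_) ds → Linked ℕ∣._∣_ ds →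
                      Linked ℕ∣._∣_ (replicate m k ++ ds)
Linked-replicate-++ ℕ.zero    _    linked = linked
Linked-replicate-++ (ℕ.suc m) k∣ds linked = Linked-∷
  (All.++⁺ (All.replicate⁺ m ℕ∣.∣-refl) k∣ds) (Linked-replicate-++ m k∣ds linked)

product-replicate : ∀ m k → product (replicate m k) ≡ k ℕ.^ m
product-replicate ℕ.zero    k = refl
product-replicate (ℕ.suc m) k = cong (k ℕ.*_) (product-replicate m k)

^-distribʳ-* : ∀ a b m → (a ℕ.* b) ℕ.^ m ≡ a ℕ.^ m ℕ.* b ℕ.^ m
^-distribʳ-* a b ℕ.zero    = refl
^-distribʳ-* a b (ℕ.suc m) = trans (cong (a ℕ.* b ℕ.*_) (^-distribʳ-* a b m))
  (ℕ.[m*n]*[o*p]≡[m*o]*[n*p] a b (a ℕ.^ m) (b ℕ.^ m))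

module _ (n q d a b : ℕ) where

  factors : List ℕ
  factors = replicate a n ++ replicate b (n ℕ.* q) ++ [ d ℕ.* n ℕ.* q ]

  factors-nontrivial : 1 ℕ.< n → .{{NonZero q}} → .{{NonZero d}} → All (1 ℕ.<_) factors
  factors-nontrivial 1<n = All.++⁺ (All.replicate⁺ a 1<n) (All.++⁺ (All.replicate⁺ b 1<nq) (1<dnq ∷ []))
    where
    1<nq : 1 ℕ.< n ℕ.* q
    1<nq = ℕ.<-≤-trans 1<n (ℕ.m≤m*n n q)

    1<dnq : 1 ℕ.< d ℕ.* n ℕ.* q
    1<dnq = subst (1 ℕ.<_) (sym (ℕ.*-assoc d n q)) (ℕ.<-≤-trans 1<nq (ℕ.m≤n*m (n ℕ.* q) d))

  factors-linked : Linked ℕ∣._∣_ factors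
  factors-linked = Linked-replicate-++ a
    (All.++⁺ (All.replicate⁺ b n∣nq) (ℕ∣.∣-trans n∣nq nq∣dnq ∷ []))
    (Linked-replicate-++ b (nq∣dnq ∷ []) [-])
    where
    n∣nq : n ℕ∣.∣ n ℕ.* q
    n∣nq = ℕ∣.m∣m*n q

    nq∣dnq : n ℕ.* q ℕ∣.∣ d ℕ.* n ℕ.* q
    nq∣dnq = ℕ∣.divides d (ℕ.*-assoc d n q)

  factors-≅ : (ℤ/ n) ^^ a ⊕ (ℤ/ (n ℕ.* q)) ^^ b ⊕ ℤ/ (d ℕ.* n ℕ.* q) ≅ cyclicSum factors
  factors-≅ = cyclicSum-replicate {B = ((ℤ/ (n ℕ.* q)) ^^ b) ⊕ ℤ/ (d ℕ.* n ℕ.* q)} n a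
    (cyclicSum-replicate {B = ℤ/ (d ℕ.* n ℕ.* q)} (n ℕ.* q) b cyclicSum-[ d ℕ.* n ℕ.* q ])

  factors-length : length factors ≡ a ℕ.+ (b ℕ.+ 1)
  factors-length = begin
    length factors
      ≡⟨ length-++ (replicate a n) ⟩
    length (replicate a n) ℕ.+ length (replicate b (n ℕ.* q) ++ [ d ℕ.* n ℕ.* q ])
      ≡⟨ cong₂ ℕ._+_ (length-replicate a) (length-++ (replicate b (n ℕ.* q))) ⟩
    a ℕ.+ (length (replicate b (n ℕ.* q)) ℕ.+ 1)
      ≡⟨ cong (λ l → a ℕ.+ (l ℕ.+ 1)) (length-replicate b) ⟩
    a ℕ.+ (b ℕ.+ 1) ∎
    where open ≡-Reasoning

  factors-product : product factors ≡ n ℕ.^ (a ℕ.+ (b ℕ.+ 1)) ℕ.* q ℕ.^ (ℕ.suc b) ℕ.* d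
  factors-product = begin
    product factors
      ≡⟨ product-++ (replicate a n) (replicate b (n ℕ.* q) ++ [ d ℕ.* n ℕ.* q ]) ⟩
    product (replicate a n) ℕ.* product (replicate b (n ℕ.* q) ++ [ d ℕ.* n ℕ.* q ])
      ≡⟨ cong₂ ℕ._*_ (product-replicate a n) (product-++ (replicate b (n ℕ.* q)) [ d ℕ.* n ℕ.* q ]) ⟩
    n ℕ.^ a ℕ.* (product (replicate b (n ℕ.* q)) ℕ.* (d ℕ.* n ℕ.* q ℕ.* 1))
      ≡⟨ cong (λ p → n ℕ.^ a ℕ.* (p ℕ.* (d ℕ.* n ℕ.* q ℕ.* 1)))
           (trans (product-replicate b (n ℕ.* q)) (^-distribʳ-* n q b)) ⟩
    n ℕ.^ a ℕ.* (n ℕ.^ b ℕ.* q ℕ.^ b ℕ.* (d ℕ.* n ℕ.* q ℕ.* 1))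
      ≡⟨ identity (n ℕ.^ a) (n ℕ.^ b) (q ℕ.^ b) d n q ⟩
    n ℕ.^ a ℕ.* (n ℕ.^ b ℕ.* (n ℕ.* 1)) ℕ.* (q ℕ.* q ℕ.^ b) ℕ.* d
      ≡⟨ cong (λ p → n ℕ.^ a ℕ.* p ℕ.* q ℕ.^ ℕ.suc b ℕ.* d) (ℕ.^-distribˡ-+-* n b 1) ⟨
    n ℕ.^ a ℕ.* n ℕ.^ (b ℕ.+ 1) ℕ.* q ℕ.^ ℕ.suc b ℕ.* d
      ≡⟨ cong (λ p → p ℕ.* q ℕ.^ ℕ.suc b ℕ.* d) (ℕ.^-distribˡ-+-* n a (b ℕ.+ 1)) ⟨
    n ℕ.^ (a ℕ.+ (b ℕ.+ 1)) ℕ.* q ℕ.^ ℕ.suc b ℕ.* d ∎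
    where
    open ≡-Reasoning

    identity : ∀ x y z d n q →
      x ℕ.* (y ℕ.* z ℕ.* (d ℕ.* n ℕ.* q ℕ.* 1)) ≡ x ℕ.* (y ℕ.* (n ℕ.* 1)) ℕ.* (q ℕ.* z) ℕ.* d
    identity = ℕ-Solver.solve-∀

-- Order, invariant factors and rank from the decomposition

module _ {x ℓ : Level} {A : AbelianGroup x ℓ} {n q d a b r c : ℕ}
         .{{_ : NonZero q}} .{{_ : NonZero d}}
         (1<n : 1 ℕ.< n) (r≡ : a ℕ.+ (b ℕ.+ 1) ≡ r) (c≡ : ℕ.suc b ≡ c)
         (A≅ : A ≅ (ℤ/ n) ^^ a ⊕ (ℤ/ (n ℕ.* q)) ^^ b ⊕ ℤ/ (d ℕ.* n ℕ.* q)) where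

  factors-invariant : InvariantFactors A (factors n q d a b)
  factors-invariant = record
    { nontrivial    = factors-nontrivial n q d a b 1<n
    ; divisibility  = factors-linked n q d a b
    ; decomposition = ≅-trans {A = A} {B = (ℤ/ n) ^^ a ⊕ (ℤ/ (n ℕ.* q)) ^^ b ⊕ ℤ/ (d ℕ.* n ℕ.* q)}
        {C = cyclicSum (factors n q d a b)} A≅ (factors-≅ n q d a b)
    }

  decomposition⇒order : HasOrder A (n ℕ.^ r ℕ.* q ℕ.^ c ℕ.* d)
  decomposition⇒order = subst (HasOrder A)
    (trans (factors-product n q d a b) (cong₂ (λ r c → n ℕ.^ r ℕ.* q ℕ.^ c ℕ.* d) r≡ c≡))
    (invariantFactors⇒order {A = A} factors-invariant)

  decomposition⇒factors : ∃ λ ds → InvariantFactors A ds × length ds ≡ r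
  decomposition⇒factors = factors n q d a b , factors-invariant , trans (factors-length n q d a b) r≡

  decomposition⇒rank : MinimalNumberOfGenerators A r
  decomposition⇒rank = subst (MinimalNumberOfGenerators A) (trans (factors-length n q d a b) r≡)
    (invariantFactors⇒rank {A = A} factors-invariant)

exponent : ∀ {n d} → 4 ℕ.≤ n → 3 ℕ.≤ d →
           ((n ℕ.∸ 4) ℕ.* d ℕ.+ 2) ℕ.+ ((d ℕ.∸ 2) ℕ.+ 1) ≡ (n ℕ.∸ 3) ℕ.* d ℕ.+ 1
exponent {ℕ.suc (ℕ.suc (ℕ.suc (ℕ.suc m)))} {ℕ.suc (ℕ.suc (ℕ.suc k))}
  (s≤s (s≤s (s≤s (s≤s z≤n)))) (s≤s (s≤s (s≤s z≤n))) = identity (m ℕ.* (3 ℕ.+ k)) k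
  where
  identity : ∀ x k → (x ℕ.+ 2) ℕ.+ (1 ℕ.+ k ℕ.+ 1) ≡ 3 ℕ.+ k ℕ.+ x ℕ.+ 1
  identity = ℕ-Solver.solve-∀

-- Matching on the two bounds exposes n = 4 + m and d = 3 + k, so that the truncated subtractions
-- compute.
jacobian≅ : ∀ n d → 4 ℕ.≤ n → 3 ℕ.≤ d → ∀ v → Jacobian (singleVoltageCover n d) v ≅
  (ℤ/ n) ^^ ((n ℕ.∸ 4) ℕ.* d ℕ.+ 2) ⊕ (ℤ/ (n ℕ.* (n ℕ.∸ 2))) ^^ (d ℕ.∸ 2) ⊕ ℤ/ (d ℕ.* n ℕ.* (n ℕ.∸ 2))
jacobian≅ (ℕ.suc (ℕ.suc (ℕ.suc (ℕ.suc m)))) (ℕ.suc (ℕ.suc (ℕ.suc k)))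
  (s≤s (s≤s (s≤s (s≤s z≤n)))) (s≤s (s≤s (s≤s z≤n))) = SingleVoltageJacobian.Jacobian≅Target m k

open import Data.Nat.Base using (_+_; _*_; _∸_; _^_; _≤_)

theorem1 : ∀ (n d : ℕ) → 4 ≤ n → 3 ≤ d → (v : Fin (n * d)) →
    let J = Jacobian (singleVoltageCover n d) v in
    (J ≅ (ℤ/ n) ^^ ((n ∸ 4) * d + 2) ⊕ (ℤ/ (n * (n ∸ 2))) ^^ (d ∸ 2) ⊕ ℤ/ (d * n * (n ∸ 2)))
    × HasOrder J (n ^ ((n ∸ 3) * d + 1) * (n ∸ 2) ^ (d ∸ 1) * d)
    × (∃ λ (ds : List ℕ) → InvariantFactors J ds × length ds ≡ (n ∸ 3) * d + 1)
    × MinimalNumberOfGenerators J ((n ∸ 3) * d + 1)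
theorem1 n d 4≤n 3≤d v =
  J≅ , decomposition⇒order {A = J} 1<n r≡ c≡ J≅ , decomposition⇒factors {A = J} 1<n r≡ c≡ J≅ ,
  decomposition⇒rank {A = J} 1<n r≡ c≡ J≅
  where
  J : AbelianGroup 0ℓ 0ℓ
  J = Jacobian (singleVoltageCover n d) v

  J≅ : J ≅ (ℤ/ n) ^^ ((n ∸ 4) * d + 2) ⊕ (ℤ/ (n * (n ∸ 2))) ^^ (d ∸ 2) ⊕ ℤ/ (d * n * (n ∸ 2))
  J≅ = jacobian≅ n d 4≤n 3≤d v

  1<n : 1 ℕ.< n
  1<n = ℕ.≤-trans (s≤s (s≤s z≤n)) 4≤n

  r≡ : ((n ∸ 4) * d + 2) + ((d ∸ 2) + 1) ≡ (n ∸ 3) * d + 1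
  r≡ = exponent 4≤n 3≤d

  c≡ : ℕ.suc (d ∸ 2) ≡ d ∸ 1
  c≡ = sym (ℕ.+-∸-assoc 1 (ℕ.≤-trans (s≤s (s≤s z≤n)) 3≤d))

  instance
    n∸2≢0 : NonZero (n ∸ 2)
    n∸2≢0 = ℕ.>-nonZero (ℕ.m<n⇒0<n∸m (ℕ.≤-trans (s≤s (s≤s (s≤s z≤n))) 4≤n))

    d≢0 : NonZero d
    d≢0 = ℕ.>-nonZero (ℕ.≤-trans (s≤s z≤n) 3≤d)
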